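{- Let $k\ge 3$ be fixed and $n\ge 3k\binom{2k}{k}$. Let $\mathcal{F}\subset\binom{[n]}{k}$ be a family that is $(3,2k)$-conditionally intersecting but not intersecting. Then $|\mathcal{F}|\le\binom{n-k-1}{k-1}+1$.
   Context: $[n]=\{1,\ldots,n\}$, and $\binom{[n]}{k}$ denotes the collection of all $k$-element subsets of $[n]$. A family $\mathcal{F}\subset\binom{[n]}{k}$ is called $(d,s)$-conditionally intersecting if there do not exist $d$ distinct sets $A_1,\ldots,A_d\in\mathcal{F}$ with $|A_1\cup\cdots\cup A_d|\le s$ and $A_1\cap\cdots\cap A_d=\emptyset$; here $d=3$ and $s=2k$. A family is intersecting if every two of its members have nonempty intersection. -}

module Defs where

open import Data.Fin.Subset using (Subset; ∣_∣; ⋃; ⋂; _∩_; Empty; Nonempty)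
open import Data.List.Base using (List; length)
open import Data.List.Membership.Propositional using (_∈_)
open import Data.List.Relation.Unary.All using (All)
open import Data.List.Relation.Unary.Unique.Propositional using (Unique)
open import Data.Nat.Base using (ℕ; _≤_)
open import Data.Product.Base using (∃-syntax; _×_)
open import Relation.Binary.PropositionalEquality.Core using (_≡_)
open import Relation.Nullary.Negation.Core using (¬_)

-- A family of k-element subsets of [n], with Fin n playing the role of [n].
-- The family is a set, represented by a list without repetitions, so that
-- the length of the list is the cardinality of the family.
record Family (n k : ℕ) : Set where
  field
    members  : List (Subset n)
    distinct : Unique members
    uniform  : All (λ A → ∣ A ∣ ≡ k) members

open Family public

card : ∀ {n k} → Family n k → ℕ
card F = length (members F)

ConditionallyIntersecting : ∀ {n k} → ℕ → ℕ → Family n k → Set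
ConditionallyIntersecting {n} d s F =
  ¬ (∃[ As ] length {A = Subset n} As ≡ d × Unique As × All (_∈ members F) As
           × ∣ ⋃ As ∣ ≤ s × Empty (⋂ As))

-- A and B are not required to differ: this only matters for empty members,
-- which a k-uniform family with k ≥ 1 does not have.
Intersecting : ∀ {n k} → Family n k → Set
Intersecting F =
  ∀ {A B} → A ∈ members F → B ∈ members F → Nonempty (A ∩ B)

{-# OPTIONS --safe #-}

-- If A − c lies in a second member, then no member meets A in {c} alone: the two members
-- and A would be three sets with empty intersection and union of size at most 2k. Call c
-- shared in A in that case, and write c ⇒ x if every member through c contains x. A point c
-- with no such x is shared in few members: these pairwise meet, and meet every other member
-- through c, outside c. If c ⇒ x, then A − x lies in no other member, for every member A
-- through c. Hence, apart from few exceptions, each member A has two private facets or is a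
-- star: A − z consists of points c ⇒ z. As the private facets number at most C(n, k − 1), a
-- family of the critical size has a vertex x with c ⇒ x for more than 4n/5 of the points c.
--
-- Members avoiding x live on the remaining points. Fix such a member B and charge every other
-- member D that either meets B or avoids x to the sets A ∋ x disjoint from B that are missing
-- from the family. If |{x} ∪ (D − B)| < k, then all such A containing D − B are missing,
-- since A ∪ B ⊇ D (near members). Otherwise D avoids x and meets B in at most one point (far
-- members); then, for every (k − 2)-set R of points c ⇒ x, at most one point c of D − B
-- extends {x} ∪ R to a member, so D − B has holes, and facets of D private among the far
-- members, or shared points if there are none, bound the number of such D.

module Submission where

open import Defs
open import Data.Nat.Base hiding (∣_-_∣)
open import Data.Nat.Properties
open import Data.Nat.Combinatorics using (_C_; nCn≡1; nC1≡n; nCk≡nC[n∸k]; nCk+nC[k+1]≡[n+1]C[k+1]; k>n⇒nCk≡0)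
open import Data.Nat.Solver using (module +-*-Solver)
open +-*-Solver using (solve; _:+_; _:*_; _:=_; con)
open import Data.Nat.ListAction using (sum)
open import Data.Bool.Properties using () renaming (_≟_ to _≟ᵇ_)
open import Data.Vec.Base as Vec using ([]; _∷_; here; there)
open import Data.Vec.Properties using (≡-dec; ∷-injectiveʳ; lookup∘tabulate; lookup⇒[]=; []=⇒lookup)
open import Data.Fin.Base using (Fin; zero; suc)
open import Data.Fin.Properties as Finₚ using ()
open import Data.Fin.Subset using (Subset; inside; outside; ∣_∣; _∪_; _∩_; _─_; _-_; ⁅_⁆; ∁; ⊤; ⊥; Nonempty)
  renaming (_∈_ to _∈ˢ_; _∉_ to _∉ˢ_; _⊆_ to _⊆ˢ_)
open import Data.Fin.Subset.Properties
open import Data.List.Base using (List; []; _∷_; [_]; map; length; _++_; filter; allFin)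
open import Data.List.Properties using (length-map; length-++; length-tabulate; map-cong)
open import Data.List.Membership.Propositional using (_∈_; _∉_; find; lose)
open import Data.List.Membership.Propositional.Properties
open import Data.List.Relation.Unary.Any as Any using (Any; here; there)
open import Data.List.Relation.Unary.All as All using (All; []; _∷_)
open import Data.List.Relation.Unary.All.Properties using (¬All⇒Any¬)
open import Data.List.Relation.Unary.AllPairs using ([]; _∷_)
open import Data.List.Relation.Unary.Unique.Propositional using (Unique)
import Data.List.Relation.Unary.Unique.Propositional.Properties as Uniqueₚ
open import Data.Product.Base using (_×_; _,_; proj₁; proj₂; ∃-syntax)
open import Data.Sum.Base using (_⊎_; inj₁; inj₂; [_,_]′)
open import Data.Empty using (⊥-elim)
open import Function.Base using (_∘_; id; case_of_)
open import Relation.Binary.PropositionalEquality hiding ([_])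
open import Relation.Nullary
open import Relation.Nullary.Decidable using (¬?; _×-dec_; _→-dec_; dec-true)

-- Sums over lists

⟦_⟧ : ∀ {p} {P : Set p} → Dec P → ℕ
⟦ yes _ ⟧ = 1
⟦ no  _ ⟧ = 0

⟦⟧-yes : ∀ {p} {P : Set p} (d : Dec P) → P → 1 ≤ ⟦ d ⟧
⟦⟧-yes (yes _) _ = ≤-refl
⟦⟧-yes (no ¬p) p = contradiction p ¬p

⟦⟧≤ : ∀ {p} {P : Set p} (d : Dec P) {m} → (P → 1 ≤ m) → ⟦ d ⟧ ≤ m
⟦⟧≤ (yes p) h = h p
⟦⟧≤ (no _)  _ = z≤n

⟦⟧⁻ : ∀ {p} {P : Set p} (d : Dec P) → 1 ≤ ⟦ d ⟧ → P
⟦⟧⁻ (yes p) _ = p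
⟦⟧⁻ (no _) ()

∑ : ∀ {A : Set} → List A → (A → ℕ) → ℕ
∑ xs f = sum (map f xs)

module _ {A : Set} where

  ∑-mono : ∀ (xs : List A) {f g} → (∀ {x} → x ∈ xs → f x ≤ g x) → ∑ xs f ≤ ∑ xs g
  ∑-mono []       h = z≤n
  ∑-mono (x ∷ xs) h = +-mono-≤ (h (here refl)) (∑-mono xs (h ∘ there))

  ∑-distrib-+ : ∀ (xs : List A) f g → ∑ xs (λ x → f x + g x) ≡ ∑ xs f + ∑ xs g
  ∑-distrib-+ []       f g = refl
  ∑-distrib-+ (x ∷ xs) f g = begin
    f x + g x + ∑ xs (λ y → f y + g y)   ≡⟨ cong (f x + g x +_) (∑-distrib-+ xs f g) ⟩
    f x + g x + (∑ xs f + ∑ xs g)        ≡⟨ solve 4 (λ a b c d → a :+ b :+ (c :+ d) := a :+ c :+ (b :+ d)) refl (f x) (g x) _ _ ⟩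
    f x + ∑ xs f + (g x + ∑ xs g)        ∎
    where open ≡-Reasoning

  ∑-const : ∀ (xs : List A) c → ∑ xs (λ _ → c) ≡ length xs * c
  ∑-const []       c = refl
  ∑-const (x ∷ xs) c = cong (c +_) (∑-const xs c)

  ∑-1 : ∀ (xs : List A) → ∑ xs (λ _ → 1) ≡ length xs
  ∑-1 xs = trans (∑-const xs 1) (*-identityʳ _)

  ∑-*ʳ : ∀ (xs : List A) f c → ∑ xs (λ x → f x * c) ≡ ∑ xs f * c
  ∑-*ʳ []       f c = refl
  ∑-*ʳ (x ∷ xs) f c = trans (cong (f x * c +_) (∑-*ʳ xs f c)) (sym (*-distribʳ-+ c (f x) _))

  ∑-≥ : ∀ {xs : List A} f {x} → x ∈ xs → f x ≤ ∑ xs f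
  ∑-≥ f (here refl) = m≤m+n _ _
  ∑-≥ f (there x∈)  = ≤-trans (∑-≥ f x∈) (m≤n+m _ _)

  ∑-≥2 : ∀ {xs : List A} f {x y} → x ∈ xs → y ∈ xs → x ≢ y → f x + f y ≤ ∑ xs f
  ∑-≥2 f (here refl) (here refl) x≢y = contradiction refl x≢y
  ∑-≥2 f (here refl) (there y∈)  _   = +-monoʳ-≤ _ (∑-≥ f y∈)
  ∑-≥2 f {x} {y} (there x∈) (here refl)  _   = ≤-trans (≤-reflexive (+-comm (f x) (f y))) (+-monoʳ-≤ _ (∑-≥ f x∈))
  ∑-≥2 f (there x∈)  (there y∈)  x≢y = ≤-trans (∑-≥2 f x∈ y∈ x≢y) (m≤n+m _ _)

  ∑-zero : ∀ (xs : List A) f → (∀ {x} → x ∈ xs → ¬ 1 ≤ f x) → ∑ xs f ≤ 0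
  ∑-zero []       f h = z≤n
  ∑-zero (x ∷ xs) f h = +-mono-≤ (≤-pred (≰⇒> (h (here refl)))) (∑-zero xs f (h ∘ there))

  ∑-unique : ∀ {xs : List A} f → Unique xs → (∀ {x} → x ∈ xs → f x ≤ 1) →
             (∀ {x y} → x ∈ xs → y ∈ xs → 1 ≤ f x → 1 ≤ f y → x ≡ y) → ∑ xs f ≤ 1
  ∑-unique {[]}     f _        _  _ = z≤n
  ∑-unique {x ∷ xs} f (x∉ ∷ u) ≤1 h with 1 ≤? f x
  ... | yes 1≤ = +-mono-≤ (≤1 (here refl))
                   (∑-zero xs f λ y∈ 1≤fy → All.lookup x∉ y∈ (h (here refl) (there y∈) 1≤ 1≤fy))
  ... | no  1≰ = +-mono-≤ (≤-pred (≰⇒> 1≰)) (∑-unique f u (≤1 ∘ there) (λ y∈ z∈ → h (there y∈) (there z∈)))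

  ∑-++ : ∀ (xs ys : List A) f → ∑ (xs ++ ys) f ≡ ∑ xs f + ∑ ys f
  ∑-++ []       ys f = refl
  ∑-++ (x ∷ xs) ys f = trans (cong (f x +_) (∑-++ xs ys f)) (sym (+-assoc (f x) _ _))

  ∑-extract : ∀ (ys zs : List A) f x → f x + ∑ (ys ++ zs) f ≡ ∑ (ys ++ [ x ] ++ zs) f
  ∑-extract ys zs f x = begin
    f x + ∑ (ys ++ zs) f      ≡⟨ cong (f x +_) (∑-++ ys zs f) ⟩
    f x + (∑ ys f + ∑ zs f)   ≡⟨ sym (+-assoc (f x) _ _) ⟩
    f x + ∑ ys f + ∑ zs f     ≡⟨ cong (_+ ∑ zs f) (+-comm (f x) _) ⟩
    ∑ ys f + f x + ∑ zs f     ≡⟨ +-assoc (∑ ys f) _ _ ⟩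
    ∑ ys f + (f x + ∑ zs f)   ≡⟨ sym (∑-++ ys (x ∷ zs) f) ⟩
    ∑ (ys ++ x ∷ zs) f        ∎
    where open ≡-Reasoning

  -- Each `x` not dismissed as a zero term is cut out of `ys` before the recursion; as `xs` has no
  -- repetitions, the later elements survive the cut. Allowing zero terms outside `ys` is what makes
  -- sums of indicators comparable.
  ∑-⊆ : ∀ {xs ys : List A} f g → Unique xs →
        (∀ {x} → x ∈ xs → f x ≡ 0 ⊎ (x ∈ ys × f x ≤ g x)) → ∑ xs f ≤ ∑ ys g
  ∑-⊆ {[]}     f g _        _ = z≤n
  ∑-⊆ {x ∷ xs} f g (x∉ ∷ u) h with h (here refl)
  ... | inj₁ fx≡0 rewrite fx≡0 = ∑-⊆ f g u (h ∘ there)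
  ... | inj₂ (x∈ , fx≤gx) with ∈-∃++ x∈
  ...   | ys , zs , refl = ≤-trans (+-mono-≤ fx≤gx (∑-⊆ {ys = ys ++ zs} f g u λ y∈ → drop y∈ (h (there y∈))))
                             (≤-reflexive (∑-extract ys zs g x))
    where
    drop : ∀ {y} → y ∈ xs → f y ≡ 0 ⊎ (y ∈ ys ++ x ∷ zs × f y ≤ g y) →
           f y ≡ 0 ⊎ (y ∈ ys ++ zs × f y ≤ g y)
    drop y∈ (inj₁ e) = inj₁ e
    drop y∈ (inj₂ (y∈' , le)) with ∈-++⁻ ys y∈'
    ... | inj₁ p            = inj₂ (∈-++⁺ˡ p , le)
    ... | inj₂ (here refl)  = contradiction refl (All.lookup x∉ y∈)
    ... | inj₂ (there p)    = inj₂ (∈-++⁺ʳ ys p , le)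

  count-⊆ : ∀ {xs ys : List A} {P Q : A → Set} (P? : ∀ x → Dec (P x)) (Q? : ∀ x → Dec (Q x)) → Unique xs →
            (∀ {x} → x ∈ xs → P x → x ∈ ys × Q x) → ∑ xs (λ x → ⟦ P? x ⟧) ≤ ∑ ys (λ x → ⟦ Q? x ⟧)
  count-⊆ {xs} {ys} P? Q? u h = ∑-⊆ _ _ u pt
    where
    pt : ∀ {x} → x ∈ xs → ⟦ P? x ⟧ ≡ 0 ⊎ (x ∈ ys × ⟦ P? x ⟧ ≤ ⟦ Q? x ⟧)
    pt {x} x∈ with P? x
    ... | no _  = inj₁ refl
    ... | yes p = inj₂ (proj₁ (h x∈ p) , ⟦⟧-yes (Q? x) (proj₂ (h x∈ p)))

  count≤length : ∀ {xs ys : List A} {P : A → Set} (P? : ∀ x → Dec (P x)) → Unique xs →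
                 (∀ {x} → x ∈ xs → P x → x ∈ ys) → ∑ xs (λ x → ⟦ P? x ⟧) ≤ length ys
  count≤length {xs} {ys} P? u h = ≤-trans (∑-⊆ _ (λ _ → 1) u pt) (≤-reflexive (∑-1 ys))
    where
    pt : ∀ {x} → x ∈ xs → ⟦ P? x ⟧ ≡ 0 ⊎ (x ∈ ys × ⟦ P? x ⟧ ≤ 1)
    pt {x} x∈ with P? x
    ... | no _  = inj₁ refl
    ... | yes p = inj₂ (h x∈ p , ≤-refl)

  length≤count : ∀ {xs ys : List A} {Q : A → Set} (Q? : ∀ x → Dec (Q x)) → Unique xs →
                 (∀ {x} → x ∈ xs → x ∈ ys × Q x) → length xs ≤ ∑ ys (λ x → ⟦ Q? x ⟧)
  length≤count {xs} {ys} Q? u h = ≤-trans (≤-reflexive (sym (∑-1 xs)))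
    (∑-⊆ (λ _ → 1) _ u λ x∈ → inj₂ (proj₁ (h x∈) , ⟦⟧-yes (Q? _) (proj₂ (h x∈))))

  length-filter-¬ : ∀ (xs : List A) {P : A → Set} (P? : ∀ x → Dec (P x)) →
                    ∑ xs (λ x → ⟦ P? x ⟧) + length (filter (¬? ∘ P?) xs) ≡ length xs
  length-filter-¬ []       P? = refl
  length-filter-¬ (x ∷ xs) P? with P? x
  ... | yes _ = cong suc (length-filter-¬ xs P?)
  ... | no  _ = trans (+-suc _ _) (cong suc (length-filter-¬ xs P?))

∑-swap : ∀ {A B : Set} (xs : List A) (ys : List B) (f : A → B → ℕ) →
         ∑ xs (λ x → ∑ ys (f x)) ≡ ∑ ys (λ y → ∑ xs (λ x → f x y))
∑-swap []       ys f = sym (trans (∑-const ys 0) (*-zeroʳ (length ys)))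
∑-swap (x ∷ xs) ys f = trans (cong (∑ ys (f x) +_) (∑-swap xs ys f)) (sym (∑-distrib-+ ys (f x) _))

-- Finite sets

_≟ˢ_ : ∀ {n} (p q : Subset n) → Dec (p ≡ q)
_≟ˢ_ = ≡-dec _≟ᵇ_

elems : ∀ {n} → Subset n → List (Fin n)
elems []            = []
elems (inside ∷ p)  = zero ∷ map suc (elems p)
elems (outside ∷ p) = map suc (elems p)

length-elems : ∀ {n} (p : Subset n) → length (elems p) ≡ ∣ p ∣
length-elems []            = refl
length-elems (inside ∷ p)  = cong suc (trans (length-map suc (elems p)) (length-elems p))
length-elems (outside ∷ p) = trans (length-map suc (elems p)) (length-elems p)

∈-elems⁺ : ∀ {n} {p : Subset n} {x} → x ∈ˢ p → x ∈ elems p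
∈-elems⁺ {p = inside ∷ p}  here       = here refl
∈-elems⁺ {p = inside ∷ p}  (there x∈) = there (∈-map⁺ suc (∈-elems⁺ x∈))
∈-elems⁺ {p = outside ∷ p} (there x∈) = ∈-map⁺ suc (∈-elems⁺ x∈)

∈-elems⁻ : ∀ {n} {p : Subset n} {x} → x ∈ elems p → x ∈ˢ p
∈-elems⁻ {p = inside ∷ p}  (here refl) = here
∈-elems⁻ {p = inside ∷ p}  (there x∈) with ∈-map⁻ suc x∈
... | _ , y∈ , refl = there (∈-elems⁻ y∈)
∈-elems⁻ {p = outside ∷ p} x∈ with ∈-map⁻ suc x∈
... | _ , y∈ , refl = there (∈-elems⁻ y∈)

elems-unique : ∀ {n} (p : Subset n) → Unique (elems p)
elems-unique []            = []
elems-unique (inside ∷ p)  = All.tabulate (λ y∈ 0≡y → case ∈-map⁻ suc y∈ of λ where (_ , _ , refl) → case 0≡y of λ ())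
                             ∷ Uniqueₚ.map⁺ Finₚ.suc-injective (elems-unique p)
elems-unique (outside ∷ p) = Uniqueₚ.map⁺ Finₚ.suc-injective (elems-unique p)

-- The k-element sets A with S ⊆ A ⊆ X.
interval : ∀ {n} → Subset n → Subset n → ℕ → List (Subset n)
interval []            []            zero    = [ [] ]
interval []            []            (suc k) = []
interval (inside ∷ S)  (inside ∷ X)  zero    = []
interval (inside ∷ S)  (inside ∷ X)  (suc k) = map (inside ∷_) (interval S X k)
interval (inside ∷ S)  (outside ∷ X) k       = []
interval (outside ∷ S) (outside ∷ X) k       = map (outside ∷_) (interval S X k)
interval (outside ∷ S) (inside ∷ X)  zero    = map (outside ∷_) (interval S X zero)
interval (outside ∷ S) (inside ∷ X)  (suc k) =
  map (outside ∷_) (interval S X (suc k)) ++ map (inside ∷_) (interval S X k)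

∈-interval⁺ : ∀ {n} {S X A : Subset n} {k} → S ⊆ˢ A → A ⊆ˢ X → ∣ A ∣ ≡ k → A ∈ interval S X k
∈-interval⁺ {S = []}          {[]}          {[]}          S⊆A A⊆X refl = here refl
∈-interval⁺ {S = inside ∷ S}  {inside ∷ X}  {inside ∷ A}  S⊆A A⊆X refl = ∈-map⁺ _ (∈-interval⁺ (drop-∷-⊆ S⊆A) (drop-∷-⊆ A⊆X) refl)
∈-interval⁺ {S = inside ∷ S}  {outside ∷ X} {inside ∷ A}  S⊆A A⊆X refl with () ← A⊆X here
∈-interval⁺ {S = inside ∷ S}  {X}           {outside ∷ A} S⊆A A⊆X refl with () ← S⊆A here
∈-interval⁺ {S = outside ∷ S} {outside ∷ X} {outside ∷ A} S⊆A A⊆X refl = ∈-map⁺ _ (∈-interval⁺ (drop-∷-⊆ S⊆A) (drop-∷-⊆ A⊆X) refl)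
∈-interval⁺ {S = outside ∷ S} {outside ∷ X} {inside ∷ A}  S⊆A A⊆X refl with () ← A⊆X here
∈-interval⁺ {S = outside ∷ S} {inside ∷ X}  {inside ∷ A}  S⊆A A⊆X refl =
  ∈-++⁺ʳ (map (outside ∷_) (interval S X _)) (∈-map⁺ _ (∈-interval⁺ (drop-∷-⊆ S⊆A) (drop-∷-⊆ A⊆X) refl))
∈-interval⁺ {S = outside ∷ S} {inside ∷ X}  {outside ∷ A} {zero}  S⊆A A⊆X eq =
  ∈-map⁺ _ (∈-interval⁺ (drop-∷-⊆ S⊆A) (drop-∷-⊆ A⊆X) eq)
∈-interval⁺ {S = outside ∷ S} {inside ∷ X}  {outside ∷ A} {suc k} S⊆A A⊆X eq =
  ∈-++⁺ˡ (∈-map⁺ _ (∈-interval⁺ (drop-∷-⊆ S⊆A) (drop-∷-⊆ A⊆X) eq))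

∈-interval⁻ : ∀ {n} {S X A : Subset n} {k} → A ∈ interval S X k → S ⊆ˢ A × A ⊆ˢ X × ∣ A ∣ ≡ k
∈-interval⁻ {S = []} {[]} {k = zero} (here refl) = id , id , refl
∈-interval⁻ {S = inside ∷ S} {inside ∷ X} {k = suc k} A∈ with ∈-map⁻ _ A∈
... | B , B∈ , refl with ∈-interval⁻ {S = S} {X} B∈
...   | S⊆ , ⊆X , eq = s⊆s S⊆ , s⊆s ⊆X , cong suc eq
∈-interval⁻ {S = outside ∷ S} {outside ∷ X} A∈ with ∈-map⁻ _ A∈
... | B , B∈ , refl with ∈-interval⁻ {S = S} {X} B∈
...   | S⊆ , ⊆X , eq = s⊆s S⊆ , s⊆s ⊆X , eq
∈-interval⁻ {S = outside ∷ S} {inside ∷ X} {k = zero} A∈ with ∈-map⁻ _ A∈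
... | B , B∈ , refl with ∈-interval⁻ {S = S} {X} B∈
...   | S⊆ , ⊆X , eq = s⊆s S⊆ , out⊆ ⊆X , eq
∈-interval⁻ {S = outside ∷ S} {inside ∷ X} {k = suc k} A∈ with ∈-++⁻ (map (outside ∷_) (interval S X (suc k))) A∈
... | inj₁ A∈₁ with ∈-map⁻ _ A∈₁
...   | B , B∈ , refl with ∈-interval⁻ {S = S} {X} B∈
...     | S⊆ , ⊆X , eq = s⊆s S⊆ , out⊆ ⊆X , eq
∈-interval⁻ {S = outside ∷ S} {inside ∷ X} {k = suc k} A∈ | inj₂ A∈₂ with ∈-map⁻ _ A∈₂
...   | B , B∈ , refl with ∈-interval⁻ {S = S} {X} B∈
...     | S⊆ , ⊆X , eq = out⊆ S⊆ , s⊆s ⊆X , cong suc eq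

interval-unique : ∀ {n} (S X : Subset n) k → Unique (interval S X k)
interval-unique []            []            zero    = [] ∷ []
interval-unique []            []            (suc k) = []
interval-unique (inside ∷ S)  (inside ∷ X)  zero    = []
interval-unique (inside ∷ S)  (inside ∷ X)  (suc k) = Uniqueₚ.map⁺ ∷-injectiveʳ (interval-unique S X k)
interval-unique (inside ∷ S)  (outside ∷ X) k       = []
interval-unique (outside ∷ S) (outside ∷ X) k       = Uniqueₚ.map⁺ ∷-injectiveʳ (interval-unique S X k)
interval-unique (outside ∷ S) (inside ∷ X)  zero    = Uniqueₚ.map⁺ ∷-injectiveʳ (interval-unique S X zero)
interval-unique (outside ∷ S) (inside ∷ X)  (suc k) =
  Uniqueₚ.++⁺ (Uniqueₚ.map⁺ ∷-injectiveʳ (interval-unique S X (suc k)))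
              (Uniqueₚ.map⁺ ∷-injectiveʳ (interval-unique S X k)) disjoint
  where
  disjoint : ∀ {A} → ¬ (A ∈ map (outside ∷_) (interval S X (suc k)) × A ∈ map (inside ∷_) (interval S X k))
  disjoint (p , q) with ∈-map⁻ _ p | ∈-map⁻ _ q
  ... | _ , _ , refl | _ , _ , ()

nC0≡1 : ∀ n → n C 0 ≡ 1
nC0≡1 n = trans (nCk≡nC[n∸k] {0} {n} z≤n) (nCn≡1 n)

-- The `d` points of `X` outside `S` are free, and deciding them one by one is Pascal's rule.
-- Writing the size as `∣ S ∣ + j` avoids truncated subtraction.
length-interval : ∀ {n} (S X : Subset n) {d} j → S ⊆ˢ X → ∣ X ∣ ≡ ∣ S ∣ + d →
                  length (interval S X (∣ S ∣ + j)) ≡ d C j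
length-interval []            []            zero    _   refl = refl
length-interval []            []            (suc j) _   refl = sym (k>n⇒nCk≡0 {0} {suc j} (s≤s z≤n))
length-interval (inside ∷ S)  (inside ∷ X)  j       S⊆X eq =
  trans (length-map _ (interval S X _)) (length-interval S X j (drop-∷-⊆ S⊆X) (cong pred eq))
length-interval (inside ∷ S)  (outside ∷ X) j       S⊆X _ with () ← S⊆X here
length-interval (outside ∷ S) (outside ∷ X) j       S⊆X eq =
  trans (length-map _ (interval S X _)) (length-interval S X j (drop-∷-⊆ S⊆X) eq)
length-interval (outside ∷ S) (inside ∷ X) {zero}  j S⊆X eq =
  ⊥-elim (1+n≰n (≤-trans (≤-reflexive (trans eq (+-identityʳ _))) (p⊆q⇒∣p∣≤∣q∣ (drop-∷-⊆ S⊆X))))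
length-interval (outside ∷ S) (inside ∷ X) {suc d} j S⊆X eq = go j (∣ S ∣ + j) refl
  where
  S⊆ = drop-∷-⊆ S⊆X
  eq' : ∣ X ∣ ≡ ∣ S ∣ + d
  eq' = cong pred (trans eq (+-suc _ _))
  -- `interval` splits on its size argument, and `∣ S ∣ + j` does not reduce, so it is replaced by a
  -- variable `m`.
  go : ∀ j m → ∣ S ∣ + j ≡ m → length (interval (outside ∷ S) (inside ∷ X) m) ≡ suc d C j
  go zero zero e = trans (length-map _ (interval S X 0)) (trans (subst (λ m → length (interval S X m) ≡ d C 0) e (length-interval S X 0 S⊆ eq'))
                         (trans (nC0≡1 d) (sym (nC0≡1 (suc d)))))
  go (suc j) zero e with () ← trans (sym (+-suc ∣ S ∣ j)) e
  go zero (suc m) e = begin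
    length (map (outside ∷_) (interval S X (suc m)) ++ map (inside ∷_) (interval S X m)) ≡⟨ len ⟩
    length (interval S X (suc m)) + length (interval S X m)
      ≡⟨ cong₂ _+_ (subst (λ m → length (interval S X m) ≡ d C 0) e (length-interval S X 0 S⊆ eq')) empty ⟩
    d C 0 + 0   ≡⟨ +-identityʳ _ ⟩
    d C 0       ≡⟨ trans (nC0≡1 d) (sym (nC0≡1 (suc d))) ⟩
    suc d C 0   ∎
    where
    open ≡-Reasoning
    len = trans (length-++ (map (outside ∷_) (interval S X (suc m))))
                (cong₂ _+_ (length-map _ (interval S X (suc m))) (length-map _ (interval S X m)))
    none : ∀ xs → xs ≡ interval S X m → length xs ≡ 0
    none []      _ = refl
    none (A ∷ _) q with ∈-interval⁻ {S = S} {X} {A} (subst (A ∈_) q (here refl))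
    ... | S⊆A , _ , ∣A∣ = ⊥-elim (1+n≰n (≤-trans (≤-reflexive (trans (sym e) (+-identityʳ _))) (≤-trans (p⊆q⇒∣p∣≤∣q∣ S⊆A) (≤-reflexive ∣A∣))))
    empty = none (interval S X m) refl
  go (suc j) (suc m) e = begin
    length (map (outside ∷_) (interval S X (suc m)) ++ map (inside ∷_) (interval S X m)) ≡⟨ len ⟩
    length (interval S X (suc m)) + length (interval S X m)
      ≡⟨ cong₂ _+_ (subst (λ m → length (interval S X m) ≡ d C suc j) e (length-interval S X (suc j) S⊆ eq'))
                   (subst (λ m → length (interval S X m) ≡ d C j) (cong pred (trans (sym (+-suc _ _)) e)) (length-interval S X j S⊆ eq')) ⟩
    d C suc j + d C j   ≡⟨ +-comm (d C suc j) _ ⟩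
    d C j + d C suc j   ≡⟨ nCk+nC[k+1]≡[n+1]C[k+1] d j ⟩
    suc d C suc j       ∎
    where
    open ≡-Reasoning
    len = trans (length-++ (map (outside ∷_) (interval S X (suc m))))
                (cong₂ _+_ (length-map _ (interval S X (suc m))) (length-map _ (interval S X m)))

∣p∪q∣+∣p∩q∣ : ∀ {n} (p q : Subset n) → ∣ p ∪ q ∣ + ∣ p ∩ q ∣ ≡ ∣ p ∣ + ∣ q ∣
∣p∪q∣+∣p∩q∣ []            []            = refl
∣p∪q∣+∣p∩q∣ (inside ∷ p)  (inside ∷ q)  = cong suc (trans (+-suc _ _) (trans (cong suc (∣p∪q∣+∣p∩q∣ p q)) (sym (+-suc _ _))))
∣p∪q∣+∣p∩q∣ (inside ∷ p)  (outside ∷ q) = cong suc (∣p∪q∣+∣p∩q∣ p q)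
∣p∪q∣+∣p∩q∣ (outside ∷ p) (inside ∷ q)  = trans (cong suc (∣p∪q∣+∣p∩q∣ p q)) (sym (+-suc _ _))
∣p∪q∣+∣p∩q∣ (outside ∷ p) (outside ∷ q) = ∣p∪q∣+∣p∩q∣ p q

∣p∪q∣≤ : ∀ {n} (p q : Subset n) → ∣ p ∪ q ∣ ≤ ∣ p ∣ + ∣ q ∣
∣p∪q∣≤ p q = ≤-trans (m≤m+n _ _) (≤-reflexive (∣p∪q∣+∣p∩q∣ p q))

∣p∪q∣-disjoint : ∀ {n} (p q : Subset n) → (∀ {x} → x ∈ˢ p → x ∉ˢ q) → ∣ p ∪ q ∣ ≡ ∣ p ∣ + ∣ q ∣
∣p∪q∣-disjoint {n} p q dis = trans (sym (trans (cong (∣ p ∪ q ∣ +_) ∣∩∣≡0) (+-identityʳ _))) (∣p∪q∣+∣p∩q∣ p q)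
  where
  ∣∩∣≡0 : ∣ p ∩ q ∣ ≡ 0
  ∣∩∣≡0 = trans (cong ∣_∣ (Empty-unique λ (x , x∈) → dis (p∩q⊆p p q x∈) (p∩q⊆q p q x∈))) (∣⊥∣≡0 n)

∣p─q∣+∣p∩q∣ : ∀ {n} (p q : Subset n) → ∣ p ─ q ∣ + ∣ p ∩ q ∣ ≡ ∣ p ∣
∣p─q∣+∣p∩q∣ []            []            = refl
∣p─q∣+∣p∩q∣ (inside ∷ p)  (inside ∷ q)  = trans (+-suc _ _) (cong suc (∣p─q∣+∣p∩q∣ p q))
∣p─q∣+∣p∩q∣ (inside ∷ p)  (outside ∷ q) = cong suc (∣p─q∣+∣p∩q∣ p q)
∣p─q∣+∣p∩q∣ (outside ∷ p) (inside ∷ q)  = ∣p─q∣+∣p∩q∣ p q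
∣p─q∣+∣p∩q∣ (outside ∷ p) (outside ∷ q) = ∣p─q∣+∣p∩q∣ p q

∈─⁻ : ∀ {n} {p q : Subset n} {x} → x ∈ˢ p ─ q → x ∈ˢ p × x ∉ˢ q
∈─⁻ {p = inside ∷ p}  {outside ∷ q} here = here , λ ()
∈─⁻ {p = inside ∷ p}  {inside ∷ q}  (there x∈) = let a , b = ∈─⁻ {p = p} {q} x∈ in there a , λ { (there h) → b h }
∈─⁻ {p = inside ∷ p}  {outside ∷ q} (there x∈) = let a , b = ∈─⁻ {p = p} {q} x∈ in there a , λ { (there h) → b h }
∈─⁻ {p = outside ∷ p} {inside ∷ q}  (there x∈) = let a , b = ∈─⁻ {p = p} {q} x∈ in there a , λ { (there h) → b h }
∈─⁻ {p = outside ∷ p} {outside ∷ q} (there x∈) = let a , b = ∈─⁻ {p = p} {q} x∈ in there a , λ { (there h) → b h }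

⊆∧∣∣≡⇒≡ : ∀ {n} {p q : Subset n} → p ⊆ˢ q → ∣ p ∣ ≡ ∣ q ∣ → p ≡ q
⊆∧∣∣≡⇒≡ {p = []}          {[]}          _   _ = refl
⊆∧∣∣≡⇒≡ {p = inside ∷ p}  {inside ∷ q}  p⊆q e = cong (inside ∷_) (⊆∧∣∣≡⇒≡ (drop-∷-⊆ p⊆q) (cong pred e))
⊆∧∣∣≡⇒≡ {p = inside ∷ p}  {outside ∷ q} p⊆q e with () ← p⊆q here
⊆∧∣∣≡⇒≡ {p = outside ∷ p} {inside ∷ q}  p⊆q e = ⊥-elim (1+n≰n (≤-trans (≤-reflexive (sym e)) (p⊆q⇒∣p∣≤∣q∣ (drop-∷-⊆ p⊆q))))
⊆∧∣∣≡⇒≡ {p = outside ∷ p} {outside ∷ q} p⊆q e = cong (outside ∷_) (⊆∧∣∣≡⇒≡ (drop-∷-⊆ p⊆q) e)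

∣p-x∣ : ∀ {n} {p : Subset n} {x} → x ∈ˢ p → suc ∣ p - x ∣ ≡ ∣ p ∣
∣p-x∣ {p = p} {x} x∈ = trans (sym (trans (cong (∣ p - x ∣ +_) ∣∩∣≡1) (+-comm _ 1))) (∣p─q∣+∣p∩q∣ p ⁅ x ⁆)
  where
  ∣∩∣≡1 : ∣ p ∩ ⁅ x ⁆ ∣ ≡ 1
  ∣∩∣≡1 = trans (cong ∣_∣ (⊆-antisym (p∩q⊆q p ⁅ x ⁆) λ y∈ → x∈p∩q⁺ (subst (_∈ˢ p) (sym (x∈⁅y⁆⇒x≡y x y∈)) x∈ , y∈))) (∣⁅x⁆∣≡1 x)

nonempty : ∀ {n} {p : Subset n} → 1 ≤ ∣ p ∣ → Nonempty p
nonempty {p = inside ∷ p}  _  = zero , here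
nonempty {p = outside ∷ p} 1≤ = let x , x∈ = nonempty 1≤ in suc x , there x∈

another : ∀ {n} {p : Subset n} x → 2 ≤ ∣ p ∣ → ∃[ y ] y ∈ˢ p × y ≢ x
another {p = p} x 2≤ with x ∈? p
... | no x∉ = let y , y∈ = nonempty (≤-trans (s≤s z≤n) 2≤) in y , y∈ , λ { refl → x∉ y∈ }
... | yes x∈ with nonempty {p = p - x} (≤-pred (≤-trans 2≤ (≤-reflexive (sym (∣p-x∣ x∈)))))
...   | y , y∈ = let y∈p , y∉x = ∈─⁻ {p = p} y∈ in y , y∈p , λ { refl → y∉x (x∈⁅x⁆ y) }

⁅⁆⊆ : ∀ {n} {p : Subset n} {x} → x ∈ˢ p → ⁅ x ⁆ ⊆ˢ p
⁅⁆⊆ {p = p} {x} x∈ y∈ = subst (_∈ˢ p) (sym (x∈⁅y⁆⇒x≡y x y∈)) x∈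

∪⊆ : ∀ {n} {p q r : Subset n} → p ⊆ˢ r → q ⊆ˢ r → p ∪ q ⊆ˢ r
∪⊆ {p = p} {q} p⊆ q⊆ x∈ = [ p⊆ , q⊆ ]′ (x∈p∪q⁻ p q x∈)

∣⁅x⁆∪p∣ : ∀ {n} {p : Subset n} {x} → x ∉ˢ p → ∣ ⁅ x ⁆ ∪ p ∣ ≡ suc ∣ p ∣
∣⁅x⁆∪p∣ {p = p} {x} x∉ = trans (∣p∪q∣-disjoint ⁅ x ⁆ p λ y∈ y∈p → x∉ (subst (_∈ˢ p) (x∈⁅y⁆⇒x≡y x y∈) y∈p))
                               (cong (_+ ∣ p ∣) (∣⁅x⁆∣≡1 x))

∈⁅⁆∪⁻ : ∀ {n} {p : Subset n} {x y} → y ∈ˢ ⁅ x ⁆ ∪ p → y ≡ x ⊎ y ∈ˢ p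
∈⁅⁆∪⁻ {p = p} {x} {y} y∈ with x∈p∪q⁻ ⁅ x ⁆ p y∈
... | inj₁ y∈⁅x⁆ = inj₁ (x∈⁅y⁆⇒x≡y x y∈⁅x⁆)
... | inj₂ y∈p   = inj₂ y∈p

x∈⁅x⁆∪p : ∀ {n} (p : Subset n) x → x ∈ˢ ⁅ x ⁆ ∪ p
x∈⁅x⁆∪p p x = p⊆p∪q p (x∈⁅x⁆ x)

x∉p-x : ∀ {n} {p : Subset n} {x} → x ∉ˢ p - x
x∉p-x {p = p} {x} x∈ = proj₂ (∈─⁻ {p = p} x∈) (x∈⁅x⁆ x)

p-x⊆p : ∀ {n} (p : Subset n) x → p - x ⊆ˢ p
p-x⊆p p x = p─q⊆p p ⁅ x ⁆

⊆-restore : ∀ {n} {p q : Subset n} {x} → p - x ⊆ˢ q → x ∈ˢ q → p ⊆ˢ q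
⊆-restore {p = p} {q} {x} p-x⊆q x∈q {y} y∈p with y Finₚ.≟ x
... | yes refl = x∈q
... | no y≢x   = p-x⊆q (x∈p∧x≢y⇒x∈p-y y∈p y≢x)

∣pair∣ : ∀ {n} {x y : Fin n} → x ≢ y → ∣ ⁅ x ⁆ ∪ ⁅ y ⁆ ∣ ≡ 2
∣pair∣ {x = x} {y} x≢y = trans (∣⁅x⁆∪p∣ λ x∈ → x≢y (x∈⁅y⁆⇒x≡y y x∈)) (cong suc (∣⁅x⁆∣≡1 y))

∣triple∣ : ∀ {n} {x y z : Fin n} → x ≢ y → x ≢ z → y ≢ z → ∣ ⁅ x ⁆ ∪ (⁅ y ⁆ ∪ ⁅ z ⁆) ∣ ≡ 3
∣triple∣ {x = x} {y} {z} x≢y x≢z y≢z =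
  trans (∣⁅x⁆∪p∣ λ x∈ → [ x≢y , (λ x∈z → x≢z (x∈⁅y⁆⇒x≡y z x∈z)) ]′ (∈⁅⁆∪⁻ x∈)) (cong suc (∣pair∣ y≢z))

comprehension : ∀ {n} {P : Fin n → Set} → (∀ x → Dec (P x)) → Subset n
comprehension P? = Vec.tabulate (λ x → does (P? x))

∈-comprehension⁺ : ∀ {n} {P : Fin n → Set} (P? : ∀ x → Dec (P x)) {x} → P x → x ∈ˢ comprehension P?
∈-comprehension⁺ P? {x} p = lookup⇒[]= x _ (trans (lookup∘tabulate _ x) (dec-true (P? x) p))

∈-comprehension⁻ : ∀ {n} {P : Fin n → Set} (P? : ∀ x → Dec (P x)) {x} → x ∈ˢ comprehension P? → P x
∈-comprehension⁻ P? {x} x∈ with P? x | trans (sym (lookup∘tabulate (λ x → does (P? x)) x)) ([]=⇒lookup x∈)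
... | yes p | _ = p

-- Union bound by double counting the pairs in `R`: each `x` with `P x` is in at least one, each `y`
-- in at most `b`. The degree estimates below iterate it.
∑-cover : ∀ {A B : Set} {P : A → Set} {R : A → B → Set} (P? : ∀ x → Dec (P x)) (R? : ∀ x y → Dec (R x y))
          (xs : List A) (ys : List B) {b} →
          (∀ {x} → x ∈ xs → P x → ∃[ y ] y ∈ ys × R x y) →
          (∀ {y} → y ∈ ys → ∑ xs (λ x → ⟦ R? x y ⟧) ≤ b) →
          ∑ xs (λ x → ⟦ P? x ⟧) ≤ length ys * b
∑-cover P? R? xs ys {b} cover bound = begin
  ∑ xs (λ x → ⟦ P? x ⟧)                    ≤⟨ ∑-mono xs (λ {x} x∈ → ⟦⟧≤ (P? x) λ p → let y , y∈ , r = cover x∈ p in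
                                                ≤-trans (⟦⟧-yes (R? x y) r) (∑-≥ (λ y → ⟦ R? x y ⟧) y∈)) ⟩
  ∑ xs (λ x → ∑ ys (λ y → ⟦ R? x y ⟧))     ≡⟨ ∑-swap xs ys _ ⟩
  ∑ ys (λ y → ∑ xs (λ x → ⟦ R? x y ⟧))     ≤⟨ ∑-mono ys bound ⟩
  ∑ ys (λ _ → b)                           ≡⟨ ∑-const ys b ⟩
  length ys * b                            ∎
  where open ≤-Reasoning

∑-witness : ∀ {A : Set} (xs : List A) (f : A → ℕ) → 1 ≤ ∑ xs f → ∃[ x ] x ∈ xs × 1 ≤ f x
∑-witness (x ∷ xs) f 1≤ with 1 ≤? f x
... | yes 1≤fx = x , here refl , 1≤fx
... | no  1≰fx with ∑-witness xs f (≤-trans 1≤ (+-monoˡ-≤ (∑ xs f) (≤-pred (≰⇒> 1≰fx))))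
...   | y , y∈ , 1≤fy = y , there y∈ , 1≤fy

-- Binomial coefficients

C-monoˡ : ∀ {a b} j → a ≤ b → a C j ≤ b C j
C-monoˡ j a≤b = go (≤⇒≤′ a≤b)
  where
  step : ∀ a j → a C j ≤ suc a C j
  step a zero    = ≤-reflexive (trans (nC0≡1 a) (sym (nC0≡1 (suc a))))
  step a (suc j) = ≤-trans (m≤n+m _ (a C j)) (≤-reflexive (nCk+nC[k+1]≡[n+1]C[k+1] a j))
  go : ∀ {a b} → a ≤′ b → a C j ≤ b C j
  go ≤′-refl       = ≤-refl
  go (≤′-step a≤b) = ≤-trans (go a≤b) (step _ j)

interval-length≤ : ∀ {n} (S X : Subset n) i → S ⊆ˢ X → length (interval S X (∣ S ∣ + i)) ≤ ∣ X ∣ C i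
interval-length≤ S X i S⊆X = ≤-trans
  (≤-reflexive (length-interval S X {∣ X ∣ ∸ ∣ S ∣} i S⊆X (sym (m+[n∸m]≡n (p⊆q⇒∣p∣≤∣q∣ S⊆X)))))
  (C-monoˡ i (m∸n≤m ∣ X ∣ ∣ S ∣))

C≥1 : ∀ {a b} → b ≤ a → 1 ≤ a C b
C≥1 {a} {b} b≤a = ≤-trans (≤-reflexive (sym (nCn≡1 b))) (C-monoˡ b b≤a)

-- This identity takes the place of factorials: inequalities between binomial coefficients are
-- multiplied by the lower index and so reduced to ratios of upper indices.
absorption : ∀ a j → suc j * (suc a C suc j) ≡ suc a * (a C j)
absorption zero    zero    = refl
absorption zero    (suc j) = trans (cong (suc (suc j) *_) (k>n⇒nCk≡0 {1} {suc (suc j)} (s≤s (s≤s z≤n))))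
                                   (trans (*-zeroʳ (suc (suc j))) (sym (cong (1 *_) (k>n⇒nCk≡0 {0} {suc j} (s≤s z≤n)))))
absorption (suc a) zero    = trans (*-identityˡ _) (trans (nC1≡n (suc (suc a))) (sym (trans (cong (suc (suc a) *_) (nC0≡1 (suc a))) (*-identityʳ _))))
absorption (suc a) (suc i) = begin
  suc (suc i) * (suc (suc a) C suc (suc i))
    ≡⟨ cong (suc (suc i) *_) (sym (nCk+nC[k+1]≡[n+1]C[k+1] (suc a) (suc i))) ⟩
  suc (suc i) * (suc a C suc i + suc a C suc (suc i))
    ≡⟨ *-distribˡ-+ (suc (suc i)) (suc a C suc i) _ ⟩
  (suc a C suc i + suc i * (suc a C suc i)) + suc (suc i) * (suc a C suc (suc i))
    ≡⟨ cong₂ (λ u v → (suc a C suc i + u) + v) (absorption a i) (absorption a (suc i)) ⟩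
  (suc a C suc i + suc a * (a C i)) + suc a * (a C suc i)
    ≡⟨ trans (+-assoc (suc a C suc i) _ _) (cong (suc a C suc i +_) (sym (*-distribˡ-+ (suc a) (a C i) _))) ⟩
  suc a C suc i + suc a * (a C i + a C suc i)
    ≡⟨ cong (λ u → suc a C suc i + suc a * u) (nCk+nC[k+1]≡[n+1]C[k+1] a i) ⟩
  suc (suc a) * (suc a C suc i) ∎
  where open ≡-Reasoning

-- By `absorption` the coefficients are `a / (1 + j)` and `b / (1 + j)` times coefficients with
-- lower index `j`. The first factors are compared by hypothesis; `q ≤ p` gives `a ≤ b`, which
-- compares the second.
C-scale : ∀ {p q} a b j → q ≤ p → p * a ≤ q * b → p * (a C suc j) ≤ q * (b C suc j)
C-scale {p} {q} zero b j _ _ = ≤-trans (≤-reflexive (trans (cong (p *_) (k>n⇒nCk≡0 {0} {suc j} (s≤s z≤n))) (*-zeroʳ p))) z≤n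
C-scale {zero} (suc a) b j _ _ = z≤n
C-scale {suc p} {q} (suc a) zero j _ le with () ← ≤-trans le (≤-reflexive (*-zeroʳ q))
C-scale {p@(suc _)} {q} (suc a) (suc b) j q≤p le = *-cancelˡ-≤ (suc j) (begin
  suc j * (p * (suc a C suc j))   ≡⟨ solve 3 (λ x y z → x :* (y :* z) := y :* (x :* z)) refl (suc j) p (suc a C suc j) ⟩
  p * (suc j * (suc a C suc j))   ≡⟨ cong (p *_) (absorption a j) ⟩
  p * (suc a * (a C j))           ≡⟨ sym (*-assoc p (suc a) _) ⟩
  p * suc a * (a C j)             ≤⟨ *-mono-≤ le (C-monoˡ j a≤b) ⟩
  q * suc b * (b C j)             ≡⟨ *-assoc q (suc b) _ ⟩
  q * (suc b * (b C j))           ≡⟨ cong (q *_) (sym (absorption b j)) ⟩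
  q * (suc j * (suc b C suc j))   ≡⟨ solve 3 (λ x y z → x :* (y :* z) := y :* (x :* z)) refl q (suc j) (suc b C suc j) ⟩
  suc j * (q * (suc b C suc j))   ∎)
  where
  open ≤-Reasoning
  a≤b : a ≤ b
  a≤b = ≤-pred (*-cancelˡ-≤ p (≤-trans le (*-monoˡ-≤ (suc b) q≤p)))

-- Each of the `j` factors of the falling factorials gains a 4, because 4(a + 1) ≤ b + 1 implies 4a
-- ≤ b.
C-scale-4^ : ∀ a b j → 4 * a ≤ b → 4 ^ j * (a C j) ≤ b C j
C-scale-4^ a b zero _ = ≤-reflexive (trans (*-identityˡ _) (trans (nC0≡1 a) (sym (nC0≡1 b))))
C-scale-4^ zero b (suc j) _ = ≤-trans (≤-reflexive (trans (cong (4 ^ suc j *_) (k>n⇒nCk≡0 {0} {suc j} (s≤s z≤n))) (*-zeroʳ (4 ^ suc j)))) z≤n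
C-scale-4^ (suc a) zero (suc j) ()
C-scale-4^ (suc a) (suc b) (suc j) le = *-cancelˡ-≤ (suc j) (begin
  suc j * (4 * 4 ^ j * (suc a C suc j))   ≡⟨ solve 3 (λ x y z → x :* (y :* z) := y :* (x :* z)) refl (suc j) (4 * 4 ^ j) (suc a C suc j) ⟩
  4 * 4 ^ j * (suc j * (suc a C suc j))   ≡⟨ cong (4 * 4 ^ j *_) (absorption a j) ⟩
  4 * 4 ^ j * (suc a * (a C j))           ≡⟨ solve 4 (λ c x y z → c :* x :* (y :* z) := (c :* y) :* (x :* z)) refl 4 (4 ^ j) (suc a) (a C j) ⟩
  4 * suc a * (4 ^ j * (a C j))           ≤⟨ *-mono-≤ le (C-scale-4^ a b j 4a≤b) ⟩
  suc b * (b C j)                         ≡⟨ sym (absorption b j) ⟩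
  suc j * (suc b C suc j)                 ∎)
  where
  open ≤-Reasoning
  4a≤b : 4 * a ≤ b
  4a≤b = ≤-pred (≤-trans (s≤s (m≤n+m _ 3)) (≤-trans (≤-reflexive (sym (*-suc 4 a))) le))

m≤mC : ∀ b d → suc b + suc d ≤ (suc b + suc d) C suc b
m≤mC zero    d = ≤-reflexive (sym (nC1≡n (1 + suc d)))
m≤mC (suc b) d = begin
  suc (suc b + suc d)                                                   ≡⟨ +-comm 1 _ ⟩
  suc b + suc d + 1                                                     ≤⟨ +-mono-≤ (m≤mC b d) (C≥1 {suc b + suc d} (≤-trans (m≤m+n (suc (suc b)) d) (≤-reflexive (sym (+-suc (suc b) d))))) ⟩
  (suc b + suc d) C suc b + (suc b + suc d) C suc (suc b)               ≡⟨ nCk+nC[k+1]≡[n+1]C[k+1] (suc b + suc d) (suc b) ⟩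
  suc (suc b + suc d) C suc (suc b)                                     ∎
  where open ≤-Reasoning

-- Pascal's rule `i` times, each new term having upper index at most `t`. It measures the loss in
-- passing from n to n - k - 1.
C-telescope : ∀ m i t j → m + i ≤ suc t → (m + i) C suc j ≤ m C suc j + i * (t C j)
C-telescope m zero    t j _ = ≤-reflexive (trans (cong (_C suc j) (+-identityʳ m)) (sym (+-identityʳ _)))
C-telescope m (suc i) t j le = begin
  (m + suc i) C suc j                        ≡⟨ cong (_C suc j) (+-suc m i) ⟩
  suc (m + i) C suc j                        ≡⟨ sym (nCk+nC[k+1]≡[n+1]C[k+1] (m + i) j) ⟩
  (m + i) C j + (m + i) C suc j              ≤⟨ +-mono-≤ (C-monoˡ j (≤-pred le')) (C-telescope m i t j (≤-trans (n≤1+n _) le')) ⟩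
  t C j + (m C suc j + i * (t C j))          ≡⟨ solve 3 (λ x y z → x :+ (y :+ z) := y :+ (x :+ z)) refl (t C j) (m C suc j) (i * (t C j)) ⟩
  m C suc j + (t C j + i * (t C j))          ∎
  where
  open ≤-Reasoning
  le' = ≤-trans (≤-reflexive (sym (+-suc m i))) le

-- The exact ratio of consecutive central coefficients is 2(2k + 1) / (k + 1), which is at least 3
-- as soon as k ≥ 1.
centralBinomial-growth : ∀ k → 1 ≤ k → 3 * ((2 * k) C k) ≤ (2 * suc k) C suc k
centralBinomial-growth k 1≤k = *-cancelˡ-≤ (suc k * suc k) (begin
  suc k * suc k * (3 * ((2 * k) C k))               ≡⟨ solve 2 (λ x c → x :* x :* (con 3 :* c) := (con 3 :* x) :* (x :* c)) refl (suc k) ((2 * k) C k) ⟩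
  (3 * suc k) * (suc k * ((2 * k) C k))             ≤⟨ *-monoˡ-≤ (suc k * ((2 * k) C k)) 3≤ ⟩
  (2 * suc (2 * k)) * (suc k * ((2 * k) C k))       ≡⟨ solve 3 (λ x y z → (con 2 :* x) :* (y :* z) := (con 2 :* y) :* (x :* z)) refl (suc (2 * k)) (suc k) ((2 * k) C k) ⟩
  (2 * suc k) * (suc (2 * k) * ((2 * k) C k))       ≡⟨ cong ((2 * suc k) *_) (sym (absorption (2 * k) k)) ⟩
  (2 * suc k) * (suc k * (suc (2 * k) C suc k))     ≡⟨ solve 2 (λ x z → (con 2 :* x) :* (x :* z) := x :* ((con 2 :* x) :* z)) refl (suc k) (suc (2 * k) C suc k) ⟩
  suc k * ((2 * suc k) * (suc (2 * k) C suc k))     ≡⟨ cong (λ z → suc k * ((2 * suc k) * z)) (sym symm) ⟩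
  suc k * ((2 * suc k) * (suc (2 * k) C k))         ≡⟨ cong (λ z → suc k * (z * (suc (2 * k) C k))) 2k+2 ⟩
  suc k * (suc (suc (2 * k)) * (suc (2 * k) C k))   ≡⟨ cong (suc k *_) (sym (absorption (suc (2 * k)) k)) ⟩
  suc k * (suc k * (suc (suc (2 * k)) C suc k))     ≡⟨ sym (*-assoc (suc k) (suc k) _) ⟩
  suc k * suc k * (suc (suc (2 * k)) C suc k)       ≡⟨ cong (λ z → suc k * suc k * (z C suc k)) (sym 2k+2) ⟩
  suc k * suc k * ((2 * suc k) C suc k)             ∎)
  where
  open ≤-Reasoning
  2k+2 : 2 * suc k ≡ suc (suc (2 * k))
  2k+2 = *-suc 2 k
  3≤ : 3 * suc k ≤ 2 * suc (2 * k)
  3≤ = begin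
    3 * suc k          ≡⟨ solve 1 (λ k → con 3 :* (con 1 :+ k) := con 2 :+ con 3 :* k :+ con 1) refl k ⟩
    2 + 3 * k + 1      ≤⟨ +-monoʳ-≤ (2 + 3 * k) 1≤k ⟩
    2 + 3 * k + k      ≡⟨ solve 1 (λ k → con 2 :+ con 3 :* k :+ k := con 2 :* (con 1 :+ con 2 :* k)) refl k ⟩
    2 * suc (2 * k)    ∎
  symm : suc (2 * k) C k ≡ suc (2 * k) C suc k
  symm = trans (nCk≡nC[n∸k] {k} {suc (2 * k)} (≤-trans (m≤m+n k _) (n≤1+n _)))
               (cong (suc (2 * k) C_) (trans (cong (_∸ k) (solve 1 (λ k → con 1 :+ con 2 :* k := k :+ (con 1 :+ k)) refl k)) (m+n∸m≡n k (suc k))))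

cube-growth : ∀ y → 6 ≤ y → 10 * (suc y * suc y * suc y) ≤ 3 * (10 * (y * y * y))
cube-growth y 6≤y = begin
  10 * (suc y * suc y * suc y)
    ≡⟨ solve 1 (λ y → con 10 :* ((con 1 :+ y) :* (con 1 :+ y) :* (con 1 :+ y))
                   := con 10 :* (y :* y :* y :+ (con 3 :* (y :* y) :+ (con 3 :* y :+ con 1)))) refl y ⟩
  10 * (y * y * y + (3 * (y * y) + (3 * y + 1)))
    ≤⟨ *-monoʳ-≤ 10 (+-monoʳ-≤ (y * y * y) (+-mono-≤ (*-monoˡ-≤ (y * y) 3≤y) (≤-trans lin (*-monoˡ-≤ (y * y) 1≤y)))) ⟩
  10 * (y * y * y + (y * (y * y) + y * (y * y)))
    ≡⟨ solve 1 (λ y → con 10 :* (y :* y :* y :+ (y :* (y :* y) :+ y :* (y :* y))) := con 3 :* (con 10 :* (y :* y :* y))) refl y ⟩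
  3 * (10 * (y * y * y)) ∎
  where
  open ≤-Reasoning
  1≤y : 1 ≤ y
  1≤y = ≤-trans (s≤s z≤n) 6≤y
  3≤y : 3 ≤ y
  3≤y = ≤-trans (s≤s (s≤s (s≤s z≤n))) 6≤y
  lin : 3 * y + 1 ≤ 1 * (y * y)
  lin = begin
    3 * y + 1   ≤⟨ +-monoʳ-≤ (3 * y) 1≤y ⟩
    3 * y + y   ≡⟨ solve 1 (λ y → con 3 :* y :+ y := con 4 :* y) refl y ⟩
    4 * y       ≤⟨ *-monoˡ-≤ y (≤-trans (s≤s (s≤s (s≤s (s≤s z≤n)))) 6≤y) ⟩
    y * y       ≡⟨ sym (*-identityˡ _) ⟩
    1 * (y * y) ∎

-- 6 is the first positive value for which this is true. From there on, each step multiplies the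
-- left side by at most 3 and the right side by at least 3.
cube≤centralBinomial : ∀ {y} → 6 ≤′ y → 10 * (y * y * y) ≤ 3 * ((2 * y) C y)
cube≤centralBinomial ≤′-refl = m≤m+n 2160 612
cube≤centralBinomial (≤′-step {y} 6≤y) =
  ≤-trans (cube-growth y (≤′⇒≤ 6≤y))
    (*-monoʳ-≤ 3 (≤-trans (cube≤centralBinomial 6≤y) (centralBinomial-growth y (≤-trans (s≤s z≤n) (≤′⇒≤ 6≤y)))))

-- With k = j + 3: the size of n needed when no vertex dominates.
threshold : ℕ → ℕ
threshold j = 1 + 10 * ((2 + j) * (2 + j) * (2 + j) * (1 + j) + (4 + j) * (2 + j))

threshold≤10k⁴ : ∀ j → threshold j ≤ (3 + j) * (10 * ((3 + j) * (3 + j) * (3 + j)))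
threshold≤10k⁴ j = begin
  threshold j   ≤⟨ m≤m+n _ (649 + 820 * j + 350 * (j * j) + 50 * (j * j * j)) ⟩
  threshold j + (649 + 820 * j + 350 * (j * j) + 50 * (j * j * j))
    ≡⟨ solve 1 (λ j → con 1 :+ con 10 :* ((con 2 :+ j) :* (con 2 :+ j) :* (con 2 :+ j) :* (con 1 :+ j) :+ (con 4 :+ j) :* (con 2 :+ j))
                        :+ (con 649 :+ con 820 :* j :+ con 350 :* (j :* j) :+ con 50 :* (j :* j :* j))
                   := (con 3 :+ j) :* (con 10 :* ((con 3 :+ j) :* (con 3 :+ j) :* (con 3 :+ j)))) refl j ⟩
  (3 + j) * (10 * ((3 + j) * (3 + j) * (3 + j))) ∎
  where open ≤-Reasoning

-- For k = 3 + j ≥ 6 the two sides are separated by 10k⁴; the cubic estimate fails for k = 3, 4, 5,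
-- where the values are computed.
threshold≤ : ∀ j → threshold j ≤ 3 * (3 + j) * ((2 * (3 + j)) C (3 + j))
threshold≤ j with 3 ≤? j
... | yes 3≤j = begin
  threshold j                                       ≤⟨ threshold≤10k⁴ j ⟩
  (3 + j) * (10 * ((3 + j) * (3 + j) * (3 + j)))    ≤⟨ *-monoʳ-≤ (3 + j) (cube≤centralBinomial (≤⇒≤′ (+-monoʳ-≤ 3 3≤j))) ⟩
  (3 + j) * (3 * ((2 * (3 + j)) C (3 + j)))         ≡⟨ solve 2 (λ x c → x :* (con 3 :* c) := con 3 :* x :* c) refl (3 + j) ((2 * (3 + j)) C (3 + j)) ⟩
  3 * (3 + j) * ((2 * (3 + j)) C (3 + j))           ∎
  where open ≤-Reasoning
... | no 3≰j = small j (≰⇒> 3≰j)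
  where
  small : ∀ j → j < 3 → threshold j ≤ 3 * (3 + j) * ((2 * (3 + j)) C (3 + j))
  small 0 _ = m≤m+n 161 19
  small 1 _ = m≤m+n 691 149
  small 2 _ = m≤m+n 2161 1619
  small (suc (suc (suc _))) (s≤s (s≤s (s≤s ())))

-- By `absorption` the left side is 5a times (a - 1) C (1 + j), and 5(a - 1) ≤ 4b. The factor `a`
-- stays on the right so that, with `a` the number of leaves of a vertex, these bounds can be added
-- over all vertices.
C-scale-sum : ∀ a b j → 5 * a ≤ 4 * suc b →
              5 * ((2 + j) * (a C (2 + j))) ≤ a * (4 * (b C (1 + j)))
C-scale-sum zero b j _ =
  ≤-reflexive (trans (cong (λ z → 5 * ((2 + j) * z)) (k>n⇒nCk≡0 {0} {2 + j} (s≤s z≤n))) (cong (5 *_) (*-zeroʳ (2 + j))))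
C-scale-sum (suc a) b j le = begin
  5 * ((2 + j) * (suc a C (2 + j)))   ≡⟨ cong (5 *_) (absorption a (1 + j)) ⟩
  5 * (suc a * (a C (1 + j)))         ≡⟨ solve 2 (λ x y → con 5 :* (x :* y) := x :* (con 5 :* y)) refl (suc a) (a C (1 + j)) ⟩
  suc a * (5 * (a C (1 + j)))         ≤⟨ *-monoʳ-≤ (suc a) (C-scale a b j (n≤1+n 4) 5a≤4b) ⟩
  suc a * (4 * (b C (1 + j)))         ∎
  where
  open ≤-Reasoning
  5a≤4b : 5 * a ≤ 4 * b
  5a≤4b = +-cancelˡ-≤ 4 _ _ (≤-trans (≤-trans (n≤1+n _) (≤-reflexive (sym (*-suc 5 a)))) (≤-trans le (≤-reflexive (*-suc 4 b))))

private
  -- Multiplying by `u * v` turns `e` and `N` into multiples of `c`, and the last hypothesis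
  -- finishes. In `spread-bound`, `c₀`, `c`, `e`, `N` are l C j, (1 + l) C j, (2 + l) C (1 + j), (3
  -- + l) C (2 + j), and that hypothesis is what `threshold` encodes.
  clear-denominators : ∀ u v w m n {c₀ c e N} .{{_ : NonZero u}} .{{_ : NonZero v}} → c₀ ≤ c →
    u * e ≡ m * c → v * N ≡ n * e → m ≤ n → 10 * (v * v * v * u + w * v) ≤ m →
    10 * (n * (v * v * c₀)) + 10 * (w * e) ≤ N
  clear-denominators u v w m n {c₀} {c} {e} {N} c₀≤c ue vN m≤n le = *-cancelˡ-≤ v (*-cancelˡ-≤ u (begin
    u * (v * (10 * (n * (v * v * c₀)) + 10 * (w * e)))
      ≡⟨ solve 6 (λ u v w n c₀ e → u :* (v :* (con 10 :* (n :* (v :* v :* c₀)) :+ con 10 :* (w :* e)))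
                    := (con 10 :* (v :* v :* v :* u)) :* (n :* c₀) :+ (con 10 :* (w :* v)) :* (u :* e)) refl u v w n c₀ e ⟩
    10 * (v * v * v * u) * (n * c₀) + 10 * (w * v) * (u * e)
      ≡⟨ cong (λ z → 10 * (v * v * v * u) * (n * c₀) + 10 * (w * v) * z) ue ⟩
    10 * (v * v * v * u) * (n * c₀) + 10 * (w * v) * (m * c)
      ≤⟨ +-mono-≤ (*-monoʳ-≤ (10 * (v * v * v * u)) (*-monoʳ-≤ n c₀≤c)) (*-monoʳ-≤ (10 * (w * v)) (*-monoˡ-≤ c m≤n)) ⟩
    10 * (v * v * v * u) * (n * c) + 10 * (w * v) * (n * c)
      ≡⟨ solve 3 (λ x y z → (con 10 :* x) :* z :+ (con 10 :* y) :* z := (con 10 :* (x :+ y)) :* z) refl (v * v * v * u) (w * v) (n * c) ⟩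
    10 * (v * v * v * u + w * v) * (n * c)
      ≤⟨ *-monoˡ-≤ (n * c) le ⟩
    m * (n * c)
      ≡⟨ solve 3 (λ m n c → m :* (n :* c) := n :* (m :* c)) refl m n c ⟩
    n * (m * c)   ≡⟨ cong (n *_) (sym ue) ⟩
    n * (u * e)   ≡⟨ solve 3 (λ m n c → m :* (n :* c) := n :* (m :* c)) refl n u e ⟩
    u * (n * e)   ≡⟨ cong (u *_) (sym vN) ⟩
    u * (v * N)   ∎))
    where open ≤-Reasoning

  -- Bookkeeping in tenths. Private facets and stars account for (N + S) / 2 ≤ 9N / 10 members; the
  -- remaining tenth of `N` absorbs both the exceptions `X` and the loss `Y` between `N` and `T`.
  combine : ∀ {x X Y N S T} → 2 * x ≤ 2 * X + (N + S) → 5 * S ≤ 4 * N → N ≤ T + Y → 10 * X + 10 * Y ≤ N → x ≤ T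
  combine {x} {X} {Y} {N} {S} {T} h₁ h₂ h₃ h₄ = *-cancelˡ-≤ 10 (+-cancelʳ-≤ (10 * Y) _ _ (begin
    10 * x + 10 * Y                           ≡⟨ solve 2 (λ x y → con 10 :* x :+ y := con 5 :* (con 2 :* x) :+ y) refl x (10 * Y) ⟩
    5 * (2 * x) + 10 * Y                      ≤⟨ +-monoˡ-≤ (10 * Y) (*-monoʳ-≤ 5 h₁) ⟩
    5 * (2 * X + (N + S)) + 10 * Y            ≡⟨ solve 4 (λ x y n s → con 5 :* (con 2 :* x :+ (n :+ s)) :+ con 10 :* y
                                                    := (con 10 :* x :+ con 10 :* y) :+ (con 5 :* n :+ con 5 :* s)) refl X Y N S ⟩
    (10 * X + 10 * Y) + (5 * N + 5 * S)       ≤⟨ +-mono-≤ h₄ (+-monoʳ-≤ (5 * N) h₂) ⟩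
    N + (5 * N + 4 * N)                       ≡⟨ solve 1 (λ n → n :+ (con 5 :* n :+ con 4 :* n) := con 10 :* n) refl N ⟩
    10 * N                                    ≤⟨ *-monoʳ-≤ 10 h₃ ⟩
    10 * (T + Y)                              ≡⟨ *-distribˡ-+ 10 T Y ⟩
    10 * T + 10 * Y                           ∎))
    where open ≤-Reasoning

spread-bound : ∀ j l m {S x} → 3 + l ≡ m + (4 + j) → threshold j ≤ 3 + l →
  5 * S ≤ 4 * ((3 + l) C (2 + j)) →
  2 * x ≤ 2 * ((3 + l) * ((2 + j) * (2 + j) * (l C j))) + ((3 + l) C (2 + j) + S) →
  x ≤ m C (2 + j)
spread-bound j l m {S} {x} eq thr 5S≤ 2x≤ =
  combine {x} {(3 + l) * ((2 + j) * (2 + j) * (l C j))} {(4 + j) * ((2 + l) C (1 + j))} 2x≤ 5S≤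
    (subst (λ z → z C (2 + j) ≤ m C (2 + j) + (4 + j) * ((2 + l) C (1 + j))) (sym eq)
      (C-telescope m (4 + j) (2 + l) (1 + j) (≤-reflexive (sym eq))))
    (clear-denominators (1 + j) (2 + j) (4 + j) (2 + l) (3 + l) (C-monoˡ {l} {1 + l} j (n≤1+n l))
      (absorption (1 + l) j) (absorption (2 + l) (1 + j)) (n≤1+n (2 + l)) (≤-pred thr))

4k≤3*4^ : ∀ j → 4 * (3 + j) ≤ 3 * 4 ^ (1 + j)
4k≤3*4^ zero    = ≤-refl
4k≤3*4^ (suc j) = begin
  4 * (4 + j)           ≡⟨ solve 1 (λ j → con 4 :* (con 4 :+ j) := con 4 :* (con 3 :+ j) :+ con 4) refl j ⟩
  4 * (3 + j) + 4       ≤⟨ +-monoʳ-≤ (4 * (3 + j)) (≤-trans (m≤m+n 4 8) (≤-trans (≤-reflexive refl) (*-monoʳ-≤ 4 (s≤s (s≤s (s≤s (z≤n {j}))))))) ⟩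
  4 * (3 + j) + 4 * (3 + j) ≤⟨ m≤m+n _ _ ⟩
  4 * (3 + j) + 4 * (3 + j) + 2 * (4 * (3 + j))  ≡⟨ solve 1 (λ x → x :+ x :+ con 2 :* x := con 4 :* x) refl (4 * (3 + j)) ⟩
  4 * (4 * (3 + j))     ≤⟨ *-monoʳ-≤ 4 (4k≤3*4^ j) ⟩
  4 * (3 * 4 ^ (1 + j)) ≡⟨ solve 1 (λ x → con 4 :* (con 3 :* x) := con 3 :* (con 4 :* x)) refl (4 ^ (1 + j)) ⟩
  3 * 4 ^ (2 + j)       ∎
  where open ≤-Reasoning

-- Shrinking the ground set by a factor 4 gains `4 ^ (1 + j)`, which outweighs 4k / 3 for k = 3 + j,
-- with equality at k = 3.
C-quarter : ∀ τ ν j → 4 * τ ≤ ν → 4 * ((3 + j) * (τ C (1 + j))) ≤ 3 * (ν C (1 + j))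
C-quarter τ ν j le = begin
  4 * ((3 + j) * (τ C (1 + j)))         ≡⟨ sym (*-assoc 4 (3 + j) (τ C (1 + j))) ⟩
  4 * (3 + j) * (τ C (1 + j))           ≤⟨ *-monoˡ-≤ (τ C (1 + j)) (4k≤3*4^ j) ⟩
  3 * 4 ^ (1 + j) * (τ C (1 + j))       ≡⟨ *-assoc 3 (4 ^ (1 + j)) (τ C (1 + j)) ⟩
  3 * (4 ^ (1 + j) * (τ C (1 + j)))     ≤⟨ *-monoʳ-≤ 3 (C-scale-4^ τ ν (1 + j) le) ⟩
  3 * (ν C (1 + j))                     ∎
  where open ≤-Reasoning

divide-out : ∀ {x y z D m} → 1 ≤ D → D * x ≤ y * m → 4 * y ≤ z * D → 4 * x ≤ z * m
divide-out {x} {y} {z} {suc D} {m} _ h₁ h₂ = *-cancelˡ-≤ (suc D) (begin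
  suc D * (4 * x)   ≡⟨ solve 2 (λ d x → d :* (con 4 :* x) := con 4 :* (d :* x)) refl (suc D) x ⟩
  4 * (suc D * x)   ≤⟨ *-monoʳ-≤ 4 h₁ ⟩
  4 * (y * m)       ≡⟨ sym (*-assoc 4 y m) ⟩
  4 * y * m         ≤⟨ *-monoˡ-≤ m h₂ ⟩
  z * suc D * m     ≡⟨ solve 3 (λ z d m → z :* d :* m := d :* (z :* m)) refl z (suc D) m ⟩
  suc D * (z * m)   ∎)
  where open ≤-Reasoning

-- Here 3k ≥ 9 and 2k is at most the central coefficient. So n - 2k is at least four times the
-- number of k-subsets of a 2k-set, as the near members will require.
2k+4C≤n : ∀ k n → 3 ≤ k → 3 * k * ((2 * k) C k) ≤ n → 2 * k + 4 * ((2 * k) C k) ≤ n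
2k+4C≤n (suc k) n 3≤k le = begin
  2 * suc k + 4 * c         ≤⟨ +-monoˡ-≤ (4 * c) 2k≤c ⟩
  c + 4 * c                 ≤⟨ m≤m+n _ (4 * c) ⟩
  c + 4 * c + 4 * c         ≡⟨ solve 1 (λ c → c :+ con 4 :* c :+ con 4 :* c := con 9 :* c) refl c ⟩
  9 * c                     ≤⟨ *-monoˡ-≤ c (*-monoʳ-≤ 3 3≤k) ⟩
  3 * suc k * c             ≤⟨ le ⟩
  n                         ∎
  where
  open ≤-Reasoning
  c = (2 * suc k) C suc k
  2k≤c : 2 * suc k ≤ c
  2k≤c = subst (λ z → z ≤ z C suc k) (solve 1 (λ k → (con 1 :+ k) :+ (con 1 :+ k) := con 2 :* (con 1 :+ k)) refl k) (m≤mC k k)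

-- Private facets, shared points and the relation `⇒`

module ThreeWise {n j : ℕ} (F : Family n (3 + j)) (CI : ConditionallyIntersecting 3 (2 * (3 + j)) F) where

  k : ℕ
  k = 3 + j

  Fs : List (Subset n)
  Fs = members F

  size : ∀ {A} → A ∈ Fs → ∣ A ∣ ≡ k
  size = All.lookup (uniform F)

  -- The form in which the hypothesis is applied: any convenient `X` may bound the union, and
  -- disjointness is checked pointwise.
  forbid : ∀ {A B D} (X : Subset n) → A ∈ Fs → B ∈ Fs → D ∈ Fs → A ≢ B → A ≢ D → B ≢ D →
           A ⊆ˢ X → B ⊆ˢ X → D ⊆ˢ X → ∣ X ∣ ≤ k + k →
           ¬ (∀ {x} → x ∈ˢ A → x ∈ˢ B → x ∉ˢ D)
  forbid {A} {B} {D} X A∈ B∈ D∈ A≢B A≢D B≢D A⊆ B⊆ D⊆ ∣X∣≤ disj =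
    CI (A ∷ B ∷ D ∷ [] , refl , (A≢B ∷ A≢D ∷ []) ∷ (B≢D ∷ []) ∷ [] ∷ [] , A∈ ∷ B∈ ∷ D∈ ∷ [] ,
        ≤-trans (p⊆q⇒∣p∣≤∣q∣ (∪⊆ {p = A} A⊆ (∪⊆ {p = B} B⊆ (∪⊆ {p = D} D⊆ (⊥⊆ {p = X})))))
                (≤-trans ∣X∣≤ (≤-reflexive (cong (k +_) (sym (+-identityʳ k))))) ,
        λ (x , x∈) → let x∈A , x∈BC = x∈p∩q⁻ A (B ∩ (D ∩ ⊤)) x∈
                         x∈B , x∈D⊤ = x∈p∩q⁻ B (D ∩ ⊤) x∈BC
                     in disj x∈A x∈B (proj₁ (x∈p∩q⁻ D ⊤ x∈D⊤)))

  ⊆⇒≡ : ∀ {A D} → A ∈ Fs → D ∈ Fs → A ⊆ˢ D → A ≡ D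
  ⊆⇒≡ A∈ D∈ A⊆D = ⊆∧∣∣≡⇒≡ A⊆D (trans (size A∈) (sym (size D∈)))

  -- Only uniqueness is recorded. For `P = A - c` the inclusion in `A` is automatic; `Owned` adds it
  -- for general `P`.
  Private : Subset n → Subset n → Set
  Private P A = All (λ D → P ⊆ˢ D → D ≡ A) Fs

  private? : ∀ P A → Dec (Private P A)
  private? P A = All.all? (λ D → (P ⊆? D) →-dec (D ≟ˢ A)) Fs

  ¬private⇒ : ∀ {P A} → ¬ Private P A → ∃[ D ] D ∈ Fs × P ⊆ˢ D × D ≢ A
  ¬private⇒ {P} {A} ¬p with find (¬All⇒Any¬ (λ D → (P ⊆? D) →-dec (D ≟ˢ A)) Fs ¬p)
  ... | D , D∈ , ¬imp with P ⊆? D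
  ...   | yes P⊆D = D , D∈ , (λ {x} → P⊆D {x}) , λ D≡A → ¬imp (λ _ → D≡A)
  ...   | no  P⊈D = ⊥-elim (¬imp (λ P⊆D → ⊥-elim (P⊈D P⊆D)))

  Shared : Fin n → Subset n → Set
  Shared c A = c ∈ˢ A × ¬ Private (A - c) A

  shared? : ∀ c A → Dec (Shared c A)
  shared? c A = (c ∈? A) ×-dec ¬? (private? (A - c) A)

  -- Otherwise `A` and `D` meet in `c` alone. A second member `D′` containing `A - c` misses `c`, as
  -- it would equal `A` otherwise, so `A`, `D`, `D′` have no common point, while their union is
  -- small. For `D ≡ A` any second point of `A` serves.
  shared-meets-twice : ∀ {A D c} → A ∈ Fs → Shared c A → D ∈ Fs → c ∈ˢ D →
                       ∃[ q ] q ∈ˢ A × q ∈ˢ D × q ≢ c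
  shared-meets-twice {A} {D} {c} A∈ (c∈A , ¬priv) D∈ c∈D with nonempty? ((A ∩ D) - c)
  ... | yes (q , q∈) = let q∈AC , q∉c = ∈─⁻ {p = A ∩ D} q∈
                           q∈A , q∈D = x∈p∩q⁻ A D q∈AC
                       in q , q∈A , q∈D , λ { refl → q∉c (x∈⁅x⁆ q) }
  ... | no ¬ne with D ≟ˢ A
  ...   | yes refl = let q , q∈A , q≢c = another {p = A} c (≤-trans (s≤s (s≤s z≤n)) (≤-reflexive (sym (size A∈))))
                     in q , q∈A , q∈A , q≢c
  ...   | no D≢A with ¬private⇒ ¬priv
  ...     | D′ , D′∈ , A-c⊆D′ , D′≢A = ⊥-elim (forbid {A} {D} {D′} ((A ∪ D) ∪ D′) A∈ D∈ D′∈
                (D≢A ∘ sym) (D′≢A ∘ sym) (λ { refl → c∉D′ c∈D })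
                (p⊆p∪q D′ ∘ p⊆p∪q D) (p⊆p∪q D′ ∘ q⊆p∪q A D) (q⊆p∪q (A ∪ D) D′) ∣X∣≤ disj)
    where
    c∉D′ : c ∉ˢ D′
    c∉D′ c∈D′ = D′≢A (sym (⊆⇒≡ A∈ D′∈ (⊆-restore {p = A} (λ {x} → A-c⊆D′ {x}) c∈D′)))
    disj : ∀ {x} → x ∈ˢ A → x ∈ˢ D → x ∉ˢ D′
    disj {x} x∈A x∈D x∈D′ = ¬ne (x , x∈p∧x≢y⇒x∈p-y (x∈p∩q⁺ (x∈A , x∈D)) λ { refl → c∉D′ x∈D′ })
    ∣A-c∣ : suc ∣ A - c ∣ ≡ k
    ∣A-c∣ = trans (∣p-x∣ c∈A) (size A∈)
    ∣A∪D∣ : suc ∣ A ∪ D ∣ ≤ k + k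
    ∣A∪D∣ = begin
      suc ∣ A ∪ D ∣             ≡⟨ +-comm 1 ∣ A ∪ D ∣ ⟩
      ∣ A ∪ D ∣ + 1             ≤⟨ +-monoʳ-≤ ∣ A ∪ D ∣ (≤-trans (≤-reflexive (sym (∣⁅x⁆∣≡1 c))) (p⊆q⇒∣p∣≤∣q∣ (⁅⁆⊆ (x∈p∩q⁺ (c∈A , c∈D))))) ⟩
      ∣ A ∪ D ∣ + ∣ A ∩ D ∣     ≡⟨ ∣p∪q∣+∣p∩q∣ A D ⟩
      ∣ A ∣ + ∣ D ∣             ≡⟨ cong₂ _+_ (size A∈) (size D∈) ⟩
      k + k                     ∎
      where open ≤-Reasoning
    -- `A ∪ D` has at most 2k - 1 points because of `c`, and `D′` shares the k - 1 points of `A - c`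
    -- with it, so adds at most one.
    ∣X∣≤ : ∣ (A ∪ D) ∪ D′ ∣ ≤ k + k
    ∣X∣≤ = +-cancelʳ-≤ ∣ A - c ∣ _ _ (begin
      ∣ (A ∪ D) ∪ D′ ∣ + ∣ A - c ∣            ≤⟨ +-monoʳ-≤ ∣ (A ∪ D) ∪ D′ ∣ (p⊆q⇒∣p∣≤∣q∣ {p = A - c}
                                                    (λ {x} x∈ → x∈p∩q⁺ {p = A ∪ D} {q = D′} (p⊆p∪q D (p-x⊆p A c x∈) , A-c⊆D′ {x} x∈))) ⟩
      ∣ (A ∪ D) ∪ D′ ∣ + ∣ (A ∪ D) ∩ D′ ∣     ≡⟨ ∣p∪q∣+∣p∩q∣ (A ∪ D) D′ ⟩
      ∣ A ∪ D ∣ + ∣ D′ ∣                      ≡⟨ cong (∣ A ∪ D ∣ +_) (trans (size D′∈) (sym ∣A-c∣)) ⟩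
      ∣ A ∪ D ∣ + suc ∣ A - c ∣               ≡⟨ +-suc ∣ A ∪ D ∣ ∣ A - c ∣ ⟩
      suc ∣ A ∪ D ∣ + ∣ A - c ∣               ≤⟨ +-monoˡ-≤ ∣ A - c ∣ ∣A∪D∣ ⟩
      k + k + ∣ A - c ∣                       ∎)
      where open ≤-Reasoning

  infix 4 _⇒_ _⇒?_
  -- Vacuously true, for all `x` other than `c`, when `c` lies in no member.
  _⇒_ : Fin n → Fin n → Set
  c ⇒ x = c ≢ x × All (λ D → c ∈ˢ D → x ∈ˢ D) Fs

  _⇒?_ : ∀ c x → Dec (c ⇒ x)
  c ⇒? x = ¬? (c Finₚ.≟ x) ×-dec All.all? (λ D → (c ∈? D) →-dec (x ∈? D)) Fs

  ¬⇒⇒ : ∀ {c x} → c ≢ x → ¬ c ⇒ x → ∃[ D ] D ∈ Fs × c ∈ˢ D × x ∉ˢ D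
  ¬⇒⇒ {c} {x} c≢x ¬c⇒x with find (¬All⇒Any¬ (λ D → (c ∈? D) →-dec (x ∈? D)) Fs (λ all → ¬c⇒x (c≢x , all)))
  ... | D , D∈ , ¬imp with c ∈? D
  ...   | yes c∈D = D , D∈ , c∈D , λ x∈D → ¬imp (λ _ → x∈D)
  ...   | no  c∉D = ⊥-elim (¬imp (λ c∈D → ⊥-elim (c∉D c∈D)))

  Good : Fin n → Set
  Good c = ∃[ x ] c ⇒ x

  good? : ∀ c → Dec (Good c)
  good? c = Finₚ.any? (c ⇒?_)

  -- A member containing `A - x` contains `c`, hence also `x`, hence all of `A`.
  ⇒-private : ∀ {A c x} → A ∈ Fs → c ∈ˢ A → c ⇒ x → x ∈ˢ A × Private (A - x) A
  ⇒-private {A} {c} {x} A∈ c∈A (c≢x , all) =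
    All.lookup all A∈ c∈A ,
    All.tabulate λ D∈ A-x⊆D → sym (⊆⇒≡ A∈ D∈
      (⊆-restore {p = A} (λ {y} → A-x⊆D {y}) (All.lookup all D∈ (A-x⊆D (x∈p∧x≢y⇒x∈p-y c∈A c≢x)))))

  module _ {l} (n≡ : n ≡ 3 + l) where

    private
      size-elems : ∀ {A c} → A ∈ Fs → c ∈ˢ A → length (elems (A - c)) ≡ 2 + j
      size-elems {A} {c} A∈ c∈ = trans (length-elems (A - c)) (cong pred (trans (∣p-x∣ c∈) (size A∈)))

      triple-degree : ∀ {c q r} → c ≢ q → c ≢ r → q ≢ r →
        ∑ Fs (λ A → ⟦ (c ∈? A) ×-dec (q ∈? A) ×-dec (r ∈? A) ⟧) ≤ l C j
      triple-degree {c} {q} {r} c≢q c≢r q≢r =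
        ≤-trans (count≤length (λ A → (c ∈? A) ×-dec (q ∈? A) ×-dec (r ∈? A)) (distinct F)
                  λ A∈ (c∈ , q∈ , r∈) → ∈-interval⁺ (∪⊆ (⁅⁆⊆ c∈) (∪⊆ (⁅⁆⊆ q∈) (⁅⁆⊆ r∈))) ⊆⊤ (size A∈))
                (≤-reflexive (trans (cong (λ s → length (interval S ⊤ (s + j))) (sym ∣S∣))
                  (length-interval S ⊤ j ⊆⊤ (trans (∣⊤∣≡n n) (trans n≡ (cong (_+ l) (sym ∣S∣)))))))
        where
        S = ⁅ c ⁆ ∪ (⁅ q ⁆ ∪ ⁅ r ⁆)
        ∣S∣ = ∣triple∣ c≢q c≢r q≢r

    -- Fix one member `A₀` in which `c` is shared. Any such `A` meets it in a second point `q`; as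
    -- `c ⇒ q` fails, some member `D` contains `c` but not `q`, and `A` meets `D` in a further point
    -- `r`. There are k - 1 choices for each of `q` and `r`, and the sets through `c`, `q`, `r`
    -- number at most l C j.
    ¬good⇒few-shared : ∀ {c} → ¬ Good c → ∑ Fs (λ A → ⟦ shared? c A ⟧) ≤ (2 + j) * ((2 + j) * (l C j))
    ¬good⇒few-shared {c} ¬good with Any.any? (shared? c) Fs
    ... | no none = ≤-trans (∑-zero Fs _ λ {A} A∈ 1≤ → none (lose A∈ (⟦⟧⁻ (shared? c A) 1≤))) z≤n
    ... | yes some with find some
    ...   | A₀ , A₀∈ , c∈A₀ , ¬priv₀ =
      ≤-trans (∑-cover (shared? c) (λ A q → shared? c A ×-dec (q ∈? A)) Fs (elems (A₀ - c))
                (λ A∈ sh → let q , q∈A , q∈A₀ , q≢c = shared-meets-twice A∈ sh A₀∈ c∈A₀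
                           in q , ∈-elems⁺ (x∈p∧x≢y⇒x∈p-y q∈A₀ q≢c) , sh , q∈A)
                λ q∈ → pair-degree (λ { refl → x∉p-x {p = A₀} (∈-elems⁻ q∈) }))
              (≤-reflexive (cong (_* ((2 + j) * (l C j))) (size-elems A₀∈ c∈A₀)))
      where
      pair-degree : ∀ {q} → c ≢ q → ∑ Fs (λ A → ⟦ shared? c A ×-dec (q ∈? A) ⟧) ≤ (2 + j) * (l C j)
      pair-degree {q} c≢q with ¬⇒⇒ c≢q (λ c⇒q → ¬good (q , c⇒q))
      ... | D , D∈ , c∈D , q∉D =
        ≤-trans (∑-cover (λ A → shared? c A ×-dec (q ∈? A)) (λ A r → (c ∈? A) ×-dec (q ∈? A) ×-dec (r ∈? A))
                  Fs (elems (D - c))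
                  (λ A∈ (sh , q∈A) → let r , r∈A , r∈D , r≢c = shared-meets-twice A∈ sh D∈ c∈D
                                     in r , ∈-elems⁺ (x∈p∧x≢y⇒x∈p-y r∈D r≢c) , proj₁ sh , q∈A , r∈A)
                  λ r∈ → let r∈D-c = ∈-elems⁻ r∈ in
                         triple-degree c≢q (λ { refl → x∉p-x {p = D} r∈D-c }) (λ { refl → q∉D (p-x⊆p D c r∈D-c) }))
                (≤-reflexive (cong (_* (l C j)) (size-elems D∈ c∈D)))

-- Leaves, stars and the bound when no vertex has many leaves

module Stars {n j : ℕ} (F : Family n (3 + j)) (CI : ConditionallyIntersecting 3 (2 * (3 + j)) F) where

  open ThreeWise F CI

  -- One `x` with `c ⇒ x` is selected for each good `c`, so that the leaf sets of different vertices
  -- are disjoint. The default `c` marks points that are not good, since `c ⇒ c` is impossible.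
  target : Fin n → Fin n
  target c with good? c
  ... | yes (x , _) = x
  ... | no  _       = c

  target-spec : ∀ c → c ≢ target c → c ⇒ target c
  target-spec c c≢ with good? c
  ... | yes (_ , c⇒x) = c⇒x
  ... | no  _         = contradiction refl c≢

  good⇒target≢ : ∀ {c} → Good c → c ≢ target c
  good⇒target≢ {c} g with good? c
  ... | yes (_ , c≢x , _) = c≢x
  ... | no  ¬g            = contradiction g ¬g

  Leaf : Fin n → Fin n → Set
  Leaf z c = target c ≡ z × c ≢ z

  leaf? : ∀ z c → Dec (Leaf z c)
  leaf? z c = (target c Finₚ.≟ z) ×-dec ¬? (c Finₚ.≟ z)

  leaves : Fin n → Subset n
  leaves z = comprehension (leaf? z)

  leaf⇒ : ∀ {z c} → c ∈ˢ leaves z → c ⇒ z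
  leaf⇒ {z} {c} c∈ with ∈-comprehension⁻ (leaf? z) c∈
  ... | refl , c≢z = target-spec c c≢z

  z∉leaves : ∀ {z} → z ∉ˢ leaves z
  z∉leaves {z} z∈ = proj₂ (∈-comprehension⁻ (leaf? z) z∈) refl

  ∑∣leaves∣≤n : ∑ (allFin n) (λ z → ∣ leaves z ∣) ≤ n
  ∑∣leaves∣≤n = begin
    ∑ (allFin n) (λ z → ∣ leaves z ∣)
      ≤⟨ ∑-mono (allFin n) (λ {z} _ → ≤-trans (≤-reflexive (sym (length-elems (leaves z))))
           (length≤count (leaf? z) (elems-unique (leaves z)) λ c∈ → ∈-allFin _ , ∈-comprehension⁻ (leaf? z) (∈-elems⁻ c∈))) ⟩
    ∑ (allFin n) (λ z → ∑ (allFin n) (λ c → ⟦ leaf? z c ⟧))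
      ≡⟨ ∑-swap (allFin n) (allFin n) (λ z c → ⟦ leaf? z c ⟧) ⟩
    ∑ (allFin n) (λ c → ∑ (allFin n) (λ z → ⟦ leaf? z c ⟧))
      ≤⟨ ∑-mono (allFin n) (λ {c} _ → ∑-unique (λ z → ⟦ leaf? z c ⟧) (Uniqueₚ.allFin⁺ n) (λ {z} _ → ⟦⟧≤ (leaf? z c) λ _ → ≤-refl)
           λ {z} {z′} _ _ p q → trans (sym (proj₁ (⟦⟧⁻ (leaf? z c) p))) (proj₁ (⟦⟧⁻ (leaf? z′ c) q))) ⟩
    ∑ (allFin n) (λ _ → 1)
      ≡⟨ trans (∑-1 (allFin n)) (length-tabulate id) ⟩
    n ∎
    where open ≤-Reasoning

  Loose : Fin n → Subset n → Set
  Loose c A = ¬ Good c × Shared c A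

  loose? : ∀ c A → Dec (Loose c A)
  loose? c A = ¬? (good? c) ×-dec shared? c A

  Owned : Subset n → Subset n → Set
  Owned P A = P ⊆ˢ A × Private P A

  owned? : ∀ P A → Dec (Owned P A)
  owned? P A = (P ⊆? A) ×-dec private? P A

  Star : Fin n → Subset n → Set
  Star z A = z ∈ˢ A × A - z ⊆ˢ leaves z

  star? : ∀ z A → Dec (Star z A)
  star? z A = (z ∈? A) ×-dec ((A - z) ⊆? leaves z)

  shadows : List (Subset n)
  shadows = interval ⊥ ⊤ (2 + j)

  private
    A-z∈shadows : ∀ {A z} → A ∈ Fs → z ∈ˢ A → A - z ∈ shadows
    A-z∈shadows A∈ z∈ = ∈-interval⁺ (⊥⊆ {p = _}) ⊆⊤ (cong pred (trans (∣p-x∣ z∈) (size A∈)))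

    loose-term owned-term star-term : Subset n → ℕ
    loose-term A = ∑ (allFin n) (λ c → ⟦ loose? c A ⟧)
    owned-term A = ∑ shadows (λ P → ⟦ owned? P A ⟧)
    star-term  A = ∑ (allFin n) (λ z → ⟦ star? z A ⟧)

  -- If c ∈ A is shared and good, then target c ∈ A and A - target c is private to A.
  -- So a member without loose points has at least two private facets, or exactly one,
  -- A - z, all points of which are leaves of z.
  member-weight : ∀ {A} → A ∈ Fs → 2 ≤ 2 * loose-term A + (owned-term A + star-term A)
  member-weight {A} A∈ with Finₚ.any? (λ c → loose? c A)
  ... | yes (c , loose) = ≤-trans (*-monoʳ-≤ 2 (≤-trans (⟦⟧-yes (loose? c A) loose) (∑-≥ (λ c → ⟦ loose? c A ⟧) (∈-allFin c)))) (m≤m+n _ _)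
  ... | no ¬loose with Finₚ.any? (λ z → (z ∈? A) ×-dec private? (A - z) A)
  ...   | no ¬own = ⊥-elim (¬own (target c , ⇒-private A∈ c∈ (target-spec c (good⇒target≢ good-c))))
    where
    A≠∅ = nonempty {p = A} (≤-trans (s≤s z≤n) (≤-reflexive (sym (size A∈))))
    c = proj₁ A≠∅
    c∈ = proj₂ A≠∅
    good-c : Good c
    good-c with good? c
    ... | yes g = g
    ... | no ¬g = ⊥-elim (¬loose (c , ¬g , c∈ , λ priv → ¬own (c , c∈ , priv)))
  ...   | yes (z , z∈ , priv) with Finₚ.any? (λ y → (y ∈? A) ×-dec private? (A - y) A ×-dec ¬? (y Finₚ.≟ z))
  ...     | yes (y , y∈ , priv′ , y≢z) = ≤-trans
    (+-mono-≤ (⟦⟧-yes (owned? (A - z) A) (p-x⊆p A z , priv)) (⟦⟧-yes (owned? (A - y) A) (p-x⊆p A y , priv′)))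
    (≤-trans (∑-≥2 (λ P → ⟦ owned? P A ⟧) (A-z∈shadows A∈ z∈) (A-z∈shadows A∈ y∈)
                (λ eq → x∉p-x {p = A} (subst (y ∈ˢ_) eq (x∈p∧x≢y⇒x∈p-y y∈ y≢z))))
             (≤-trans (m≤m+n (owned-term A) (star-term A)) (m≤n+m _ (2 * loose-term A))))
  ...     | no ¬other = ≤-trans
    (+-mono-≤ (≤-trans (⟦⟧-yes (owned? (A - z) A) (p-x⊆p A z , priv)) (∑-≥ (λ P → ⟦ owned? P A ⟧) (A-z∈shadows A∈ z∈)))
              (≤-trans (⟦⟧-yes (star? z A) (z∈ , λ {c} → leaf c)) (∑-≥ (λ z → ⟦ star? z A ⟧) (∈-allFin z))))
    (m≤n+m _ (2 * loose-term A))
    where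
    leaf : ∀ c → c ∈ˢ A - z → c ∈ˢ leaves z
    leaf c c∈A-z = ∈-comprehension⁺ (leaf? z) (target≡z , c≢z)
      where
      c∈ = p-x⊆p A z c∈A-z
      c≢z : c ≢ z
      c≢z refl = x∉p-x {p = A} c∈A-z
      good-c : Good c
      good-c with good? c
      ... | yes g = g
      ... | no ¬g = ⊥-elim (¬loose (c , ¬g , c∈ , λ priv′ → ¬other (c , c∈ , priv′ , c≢z)))
      target≡z : target c ≡ z
      target≡z with target c Finₚ.≟ z
      ... | yes eq = eq
      ... | no neq = let t∈ , priv′ = ⇒-private A∈ c∈ (target-spec c (good⇒target≢ good-c))
                     in ⊥-elim (¬other (target c , t∈ , priv′ , neq))

  module _ {l} (n≡ : n ≡ 3 + l) where

    private
      ∑loose : ∑ Fs loose-term ≤ n * ((2 + j) * ((2 + j) * (l C j)))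
      ∑loose = begin
        ∑ Fs loose-term
          ≡⟨ ∑-swap Fs (allFin n) (λ A c → ⟦ loose? c A ⟧) ⟩
        ∑ (allFin n) (λ c → ∑ Fs (λ A → ⟦ loose? c A ⟧))
          ≤⟨ ∑-mono (allFin n) (λ {c} _ → per-point c (good? c)) ⟩
        ∑ (allFin n) (λ _ → (2 + j) * ((2 + j) * (l C j)))
          ≡⟨ trans (∑-const (allFin n) _) (cong (_* ((2 + j) * ((2 + j) * (l C j)))) (length-tabulate {n = n} id)) ⟩
        n * ((2 + j) * ((2 + j) * (l C j))) ∎
        where
        open ≤-Reasoning
        per-point : ∀ c → Dec (Good c) → ∑ Fs (λ A → ⟦ loose? c A ⟧) ≤ (2 + j) * ((2 + j) * (l C j))
        per-point c (yes g) = ≤-trans (∑-zero Fs _ λ {A} _ 1≤ → proj₁ (⟦⟧⁻ (loose? c A) 1≤) g) z≤n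
        per-point c (no ¬g) = ≤-trans (∑-mono Fs λ {A} _ → ⟦⟧≤ (loose? c A) λ (_ , sh) → ⟦⟧-yes (shared? c A) sh)
                                      (¬good⇒few-shared n≡ ¬g)

      -- A (k - 1)-set is owned by at most one member, so the owned pairs are no more than the (k -
      -- 1)-sets.
      ∑owned : ∑ Fs owned-term ≤ n C (2 + j)
      ∑owned = begin
        ∑ Fs owned-term
          ≡⟨ ∑-swap Fs shadows (λ A P → ⟦ owned? P A ⟧) ⟩
        ∑ shadows (λ P → ∑ Fs (λ A → ⟦ owned? P A ⟧))
          ≤⟨ ∑-mono shadows (λ {P} _ → ∑-unique (λ A → ⟦ owned? P A ⟧) (distinct F) (λ {A} _ → ⟦⟧≤ (owned? P A) λ _ → ≤-refl)
               λ {A} {D} A∈ D∈ p q → All.lookup (proj₂ (⟦⟧⁻ (owned? P D) q)) A∈ (λ {x} → proj₁ (⟦⟧⁻ (owned? P A) p) {x})) ⟩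
        ∑ shadows (λ _ → 1)    ≡⟨ ∑-1 shadows ⟩
        length shadows         ≡⟨ cong (λ s → length (interval (⊥ {n}) ⊤ (s + (2 + j)))) (sym (∣⊥∣≡0 n)) ⟩
        length (interval (⊥ {n}) ⊤ (∣ ⊥ {n} ∣ + (2 + j)))
          ≡⟨ length-interval (⊥ {n}) ⊤ (2 + j) (⊥⊆ {p = ⊤}) (trans (∣⊤∣≡n n) (cong (_+ n) (sym (∣⊥∣≡0 n)))) ⟩
        n C (2 + j) ∎
        where open ≤-Reasoning

      star-count : ∀ z → ∑ Fs (λ A → ⟦ star? z A ⟧) ≤ ∣ leaves z ∣ C (2 + j)
      star-count z = begin
        ∑ Fs (λ A → ⟦ star? z A ⟧)
          ≤⟨ count≤length (star? z) (distinct F) (λ A∈ (z∈ , A-z⊆) → ∈-interval⁺ (⁅⁆⊆ z∈)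
               (⊆-restore (λ x∈ → q⊆p∪q ⁅ z ⁆ (leaves z) (A-z⊆ x∈)) (x∈⁅x⁆∪p (leaves z) z)) (size A∈)) ⟩
        length (interval ⁅ z ⁆ (⁅ z ⁆ ∪ leaves z) (1 + (2 + j)))
          ≡⟨ cong (λ s → length (interval ⁅ z ⁆ (⁅ z ⁆ ∪ leaves z) (s + (2 + j)))) (sym (∣⁅x⁆∣≡1 z)) ⟩
        length (interval ⁅ z ⁆ (⁅ z ⁆ ∪ leaves z) (∣ ⁅ z ⁆ ∣ + (2 + j)))
          ≡⟨ length-interval ⁅ z ⁆ (⁅ z ⁆ ∪ leaves z) (2 + j) (p⊆p∪q (leaves z))
               (trans (∣⁅x⁆∪p∣ z∉leaves) (cong (_+ ∣ leaves z ∣) (sym (∣⁅x⁆∣≡1 z)))) ⟩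
        ∣ leaves z ∣ C (2 + j) ∎
        where open ≤-Reasoning

      -- After multiplication by k - 1, the stars at `z` contribute at most 4/5 of `∣ leaves z ∣`
      -- times C(n - 1, k - 2). There are at most `n` leaves in all, and `absorption` turns the
      -- product back into C(n, k - 1).
      ∑star : (∀ z → 5 * ∣ leaves z ∣ ≤ 4 * n) → 5 * ∑ Fs star-term ≤ 4 * (n C (2 + j))
      ∑star small = *-cancelˡ-≤ (2 + j) (begin
        (2 + j) * (5 * ∑ Fs star-term)
          ≤⟨ *-monoʳ-≤ (2 + j) (*-monoʳ-≤ 5 (≤-trans (≤-reflexive (∑-swap Fs (allFin n) (λ A z → ⟦ star? z A ⟧)))
                                                     (∑-mono (allFin n) (λ {z} _ → star-count z)))) ⟩
        (2 + j) * (5 * S)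
          ≡⟨ solve 3 (λ a b s → a :* (b :* s) := s :* (b :* a)) refl (2 + j) 5 S ⟩
        S * (5 * (2 + j))
          ≡⟨ sym (∑-*ʳ (allFin n) (λ z → ∣ leaves z ∣ C (2 + j)) (5 * (2 + j))) ⟩
        ∑ (allFin n) (λ z → (∣ leaves z ∣ C (2 + j)) * (5 * (2 + j)))
          ≤⟨ ∑-mono (allFin n) (λ {z} _ → ≤-trans
               (≤-reflexive (solve 3 (λ a b s → s :* (b :* a) := b :* (a :* s)) refl (2 + j) 5 (∣ leaves z ∣ C (2 + j))))
               (C-scale-sum ∣ leaves z ∣ (2 + l) j (≤-trans (small z) (≤-reflexive (cong (4 *_) n≡))))) ⟩
        ∑ (allFin n) (λ z → ∣ leaves z ∣ * (4 * e))
          ≡⟨ ∑-*ʳ (allFin n) (λ z → ∣ leaves z ∣) (4 * e) ⟩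
        ∑ (allFin n) (λ z → ∣ leaves z ∣) * (4 * e)
          ≤⟨ *-monoˡ-≤ (4 * e) ∑∣leaves∣≤n ⟩
        n * (4 * e)
          ≡⟨ cong (_* (4 * e)) n≡ ⟩
        (3 + l) * (4 * e)
          ≡⟨ solve 3 (λ a b s → a :* (b :* s) := b :* (a :* s)) refl (3 + l) 4 e ⟩
        4 * ((3 + l) * e)
          ≡⟨ cong (4 *_) (sym (absorption (2 + l) (1 + j))) ⟩
        4 * ((2 + j) * ((3 + l) C (2 + j)))
          ≡⟨ cong (λ m → 4 * ((2 + j) * (m C (2 + j)))) (sym n≡) ⟩
        4 * ((2 + j) * (n C (2 + j)))
          ≡⟨ solve 3 (λ a b s → a :* (b :* s) := b :* (a :* s)) refl 4 (2 + j) (n C (2 + j)) ⟩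
        (2 + j) * (4 * (n C (2 + j))) ∎)
        where
        open ≤-Reasoning
        S = ∑ (allFin n) (λ z → ∣ leaves z ∣ C (2 + j))
        e = (2 + l) C (1 + j)

    -- Summing `member-weight` bounds twice the cardinality by twice the loose pairs, of lower order
    -- in n, plus the owned pairs, at most C(n, k - 1), plus the stars, at most 4/5 of that. Here
    -- `m` is n - k - 1.
    no-large-star-bound : ∀ m → n ≡ m + (4 + j) → threshold j ≤ n →
                          (∀ z → 5 * ∣ leaves z ∣ ≤ 4 * n) → card F ≤ m C (2 + j)
    no-large-star-bound m n≡m+ thr small = spread-bound j l m {∑ Fs star-term}
      (trans (sym n≡) n≡m+) (≤-trans thr (≤-reflexive n≡))
      (subst (λ n → 5 * ∑ Fs star-term ≤ 4 * (n C (2 + j))) n≡ (∑star small))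
      (begin
        2 * length Fs          ≡⟨ trans (*-comm 2 (length Fs)) (sym (∑-const Fs 2)) ⟩
        ∑ Fs (λ _ → 2)         ≤⟨ ∑-mono Fs member-weight ⟩
        ∑ Fs (λ A → 2 * loose-term A + (owned-term A + star-term A))
          ≡⟨ ∑-distrib-+ Fs (λ A → 2 * loose-term A) (λ A → owned-term A + star-term A) ⟩
        ∑ Fs (λ A → 2 * loose-term A) + ∑ Fs (λ A → owned-term A + star-term A)
          ≡⟨ cong₂ _+_ (trans (cong sum (map-cong (λ A → *-comm 2 (loose-term A)) Fs)) (trans (∑-*ʳ Fs loose-term 2) (*-comm (∑ Fs loose-term) 2)))
                       (∑-distrib-+ Fs owned-term star-term) ⟩
        2 * ∑ Fs loose-term + (∑ Fs owned-term + ∑ Fs star-term)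
          ≤⟨ +-mono-≤ (*-monoʳ-≤ 2 ∑loose) (+-monoˡ-≤ (∑ Fs star-term) ∑owned) ⟩
        2 * (n * ((2 + j) * ((2 + j) * (l C j)))) + (n C (2 + j) + ∑ Fs star-term)
          ≡⟨ cong₂ (λ a b → 2 * (b * a) + (b C (2 + j) + ∑ Fs star-term)) (sym (*-assoc (2 + j) (2 + j) (l C j))) n≡ ⟩
        2 * ((3 + l) * ((2 + j) * (2 + j) * (l C j))) + ((3 + l) C (2 + j) + ∑ Fs star-term) ∎)
      where open ≤-Reasoning

-- A vertex `x` with more than 4n/5 leaves, and a member `B` avoiding it

module DominantStar {n j d m₀ : ℕ} (F : Family n (3 + j)) (CI : ConditionallyIntersecting 3 (2 * (3 + j)) F)
  (n≡k+k+d : n ≡ (3 + j) + ((3 + j) + suc d)) (n≡m₀+k+1 : n ≡ m₀ + (4 + j))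
  (x : Fin n) (dominant : 4 * n < 5 * ∣ Stars.leaves F CI x ∣)
  {B : Subset n} (B∈ : B ∈ members F) (x∉B : x ∉ˢ B) where

  open ThreeWise F CI
  open Stars F CI using (leaves; leaf⇒; z∉leaves)

  -- In this module `suc d` is n - 2k and `m₀` is n - k - 1. By `avoids-N`, `B` is disjoint from
  -- `N`, so `x`, `B`, `N` and `T` partition the ground set.
  N T : Subset n
  N = leaves x
  T = ∁ (⁅ x ⁆ ∪ (B ∪ N))

  avoids-N : ∀ {D e} → D ∈ Fs → x ∉ˢ D → e ∈ˢ D → e ∉ˢ N
  avoids-N D∈ x∉D e∈D e∈N = x∉D (All.lookup (proj₂ (leaf⇒ e∈N)) D∈ e∈D)

  ∈T⁻ : ∀ {e} → e ∈ˢ T → e ≢ x × e ∉ˢ B × e ∉ˢ N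
  ∈T⁻ {e} e∈T = (λ { refl → e∉ (x∈⁅x⁆∪p (B ∪ N) x) }) ,
                (λ e∈B → e∉ (q⊆p∪q ⁅ x ⁆ (B ∪ N) (p⊆p∪q N e∈B))) ,
                (λ e∈N → e∉ (q⊆p∪q ⁅ x ⁆ (B ∪ N) (q⊆p∪q B N e∈N)))
    where e∉ = x∈∁p⇒x∉p e∈T

  ∈T⁺ : ∀ {e} → e ≢ x → e ∉ˢ B → e ∉ˢ N → e ∈ˢ T
  ∈T⁺ e≢x e∉B e∉N = x∉p⇒x∈∁p λ e∈ → [ e≢x , (λ e∈BN → [ e∉B , e∉N ]′ (x∈p∪q⁻ B N e∈BN)) ]′ (∈⁅⁆∪⁻ e∈)

  4∣T∣≤∣N∣ : 4 * ∣ T ∣ ≤ ∣ N ∣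
  4∣T∣≤∣N∣ = +-cancelʳ-≤ (4 * ∣ N ∣) _ _ (begin
    4 * ∣ T ∣ + 4 * ∣ N ∣   ≡⟨ sym (*-distribˡ-+ 4 ∣ T ∣ ∣ N ∣) ⟩
    4 * (∣ T ∣ + ∣ N ∣)     ≡⟨ cong (4 *_) (sym (∣p∪q∣-disjoint T N λ e∈T → proj₂ (proj₂ (∈T⁻ e∈T)))) ⟩
    4 * ∣ T ∪ N ∣           ≤⟨ *-monoʳ-≤ 4 (∣p∣≤n (T ∪ N)) ⟩
    4 * n                   ≤⟨ <⇒≤ dominant ⟩
    ∣ N ∣ + 4 * ∣ N ∣       ∎)
    where open ≤-Reasoning

  member? : ∀ A → Dec (A ∈ Fs)
  member? A = Any.any? (A ≟ˢ_) Fs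

  ∣∁B∣ : ∣ ∁ B ∣ ≡ n ∸ k
  ∣∁B∣ = trans (∣∁p∣≡n∸∣p∣ B) (cong (n ∸_) (size B∈))

  -- The number of candidates is the main term of the theorem. Members other than candidates and `B`
  -- have to be paid for by missing candidates.
  candidates missing : List (Subset n)
  candidates = interval ⁅ x ⁆ (∁ B) k
  missing    = filter (¬? ∘ member?) candidates

  length-candidates : length candidates ≡ m₀ C (2 + j)
  length-candidates = trans (cong (λ s → length (interval ⁅ x ⁆ (∁ B) (s + (2 + j)))) (sym (∣⁅x⁆∣≡1 x)))
    (length-interval ⁅ x ⁆ (∁ B) (2 + j) (⁅⁆⊆ (x∉p⇒x∈∁p x∉B))
      (trans ∣∁B∣ (trans (cong (_∸ k) (trans n≡m₀+k+1 (+-suc m₀ k))) (trans (m+n∸n≡m (suc m₀) k) (cong (_+ m₀) (sym (∣⁅x⁆∣≡1 x)))))))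

  missing⁻ : ∀ {A} → A ∈ missing → x ∈ˢ A × A ⊆ˢ ∁ B × ∣ A ∣ ≡ k × A ∉ Fs
  missing⁻ {A} A∈ = let A∈c , A∉ = ∈-filter⁻ (¬? ∘ member?) {xs = candidates} A∈
                        x⊆A , A⊆∁B , ∣A∣ = ∈-interval⁻ {S = ⁅ x ⁆} {X = ∁ B} {A = A} A∈c
                    in x⊆A (x∈⁅x⁆ x) , (λ {e} → A⊆∁B {e}) , ∣A∣ , A∉

  missing⁺ : ∀ {A} → x ∈ˢ A → A ⊆ˢ ∁ B → ∣ A ∣ ≡ k → A ∉ Fs → A ∈ missing
  missing⁺ x∈A A⊆ ∣A∣ A∉ = ∈-filter⁺ (¬? ∘ member?) (∈-interval⁺ (⁅⁆⊆ x∈A) A⊆ ∣A∣) A∉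

  -- `B` satisfies the size condition of `Near`, hence its exclusion there. The size condition of
  -- `Far` says that a member has at most one point in `B`.
  Apart Near Far : Subset n → Set
  Apart D = x ∈ˢ D × D ⊆ˢ ∁ B
  Near  D = D ≢ B × ∣ ⁅ x ⁆ ∪ (D ─ B) ∣ < k
  Far   D = x ∉ˢ D × 2 + j ≤ ∣ D ─ B ∣

  apart? : ∀ D → Dec (Apart D)
  apart? D = (x ∈? D) ×-dec (D ⊆? ∁ B)

  near? : ∀ D → Dec (Near D)
  near? D = ¬? (D ≟ˢ B) ×-dec (∣ ⁅ x ⁆ ∪ (D ─ B) ∣ <? k)

  far? : ∀ D → Dec (Far D)
  far? D = ¬? (x ∈? D) ×-dec (2 + j ≤? ∣ D ─ B ∣)

  -- The decisive case is `x ∈ D`: then {x} ∪ (D - B) is just D - B, and if it still has k points,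
  -- `D` misses `B`.
  classify : ∀ {D} → D ∈ Fs → Apart D ⊎ D ≡ B ⊎ Near D ⊎ Far D
  classify {D} D∈ with D ≟ˢ B | ∣ ⁅ x ⁆ ∪ (D ─ B) ∣ <? k | x ∈? D
  ... | yes D≡B | _       | _       = inj₂ (inj₁ D≡B)
  ... | no  D≢B | yes s<k | _       = inj₂ (inj₂ (inj₁ (D≢B , s<k)))
  ... | no  _   | no  s≮k | no  x∉D = inj₂ (inj₂ (inj₂ (x∉D , ≤-pred (≤-trans (≮⇒≥ s≮k)
                                        (≤-trans (∣p∪q∣≤ ⁅ x ⁆ (D ─ B)) (≤-reflexive (cong (_+ ∣ D ─ B ∣) (∣⁅x⁆∣≡1 x))))))))
  ... | no  _   | no  s≮k | yes x∈D = inj₁ (x∈D , D⊆∁B)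
    where
    D─B≡D : D ─ B ≡ D
    D─B≡D = ⊆∧∣∣≡⇒≡ (p─q⊆p D B) (≤-antisym (∣p─q∣≤∣p∣ D B) (≤-trans (≤-reflexive (size D∈)) (≤-trans (≮⇒≥ s≮k)
              (p⊆q⇒∣p∣≤∣q∣ (∪⊆ {p = ⁅ x ⁆} (⁅⁆⊆ (x∈p∧x∉q⇒x∈p─q x∈D x∉B)) id)))))
    D⊆∁B : D ⊆ˢ ∁ B
    D⊆∁B {e} e∈D = x∉p⇒x∈∁p (proj₂ (∈─⁻ {p = D} (subst (e ∈ˢ_) (sym D─B≡D) e∈D)))

  #near #far : ℕ
  #near = ∑ Fs (λ D → ⟦ near? D ⟧)
  #far  = ∑ Fs (λ D → ⟦ far? D ⟧)

  -- The pair A, B is disjoint, so no other member lies in A ∪ B: each near member D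
  -- forces all candidates A ⊇ D ─ B to be missing.
  near-kills : ∀ {D} → D ∈ Fs → Near D → suc d ≤ ∑ missing (λ A → ⟦ D ⊆? A ∪ B ⟧)
  near-kills {D} D∈ (D≢B , s<k) with m≤n⇒∃[o]m+o≡n s<k
  ... | i , s+i≡k = begin
    suc d                                     ≤⟨ m≤n+m (suc d) (suc i) ⟩
    suc i + suc d                             ≤⟨ m≤mC i d ⟩
    (suc i + suc d) C suc i                   ≡⟨ sym (length-interval S (∁ B) (suc i) S⊆∁B ∣∁B∣≡) ⟩
    length (interval S (∁ B) (∣ S ∣ + suc i)) ≤⟨ length≤count (λ A → D ⊆? A ∪ B) (interval-unique S (∁ B) _) kill ⟩
    ∑ missing (λ A → ⟦ D ⊆? A ∪ B ⟧)          ∎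
    where
    open ≤-Reasoning
    S = ⁅ x ⁆ ∪ (D ─ B)
    s+1+i≡k : ∣ S ∣ + suc i ≡ k
    s+1+i≡k = trans (+-suc ∣ S ∣ i) s+i≡k
    S⊆∁B : S ⊆ˢ ∁ B
    S⊆∁B = ∪⊆ {p = ⁅ x ⁆} (⁅⁆⊆ (x∉p⇒x∈∁p x∉B)) (λ e∈ → x∉p⇒x∈∁p (proj₂ (∈─⁻ {p = D} e∈)))
    ∣∁B∣≡ : ∣ ∁ B ∣ ≡ ∣ S ∣ + (suc i + suc d)
    ∣∁B∣≡ = trans ∣∁B∣ (trans (cong (_∸ k) n≡k+k+d) (trans (m+n∸m≡n k (k + suc d))
              (trans (cong (_+ suc d) (sym s+1+i≡k)) (+-assoc ∣ S ∣ (suc i) (suc d)))))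
    kill : ∀ {A} → A ∈ interval S (∁ B) (∣ S ∣ + suc i) → A ∈ missing × D ⊆ˢ A ∪ B
    kill {A} A∈ with ∈-interval⁻ {S = S} {X = ∁ B} {A = A} A∈
    ... | S⊆A , A⊆∁B , ∣A∣ = missing⁺ x∈A A⊆∁B ∣A∣≡k A∉ , D⊆A∪B
      where
      ∣A∣≡k = trans ∣A∣ s+1+i≡k
      x∈A = S⊆A (x∈⁅x⁆∪p (D ─ B) x)
      D⊆A∪B : D ⊆ˢ A ∪ B
      D⊆A∪B {e} e∈D with e ∈? B
      ... | yes e∈B = q⊆p∪q A B e∈B
      ... | no  e∉B = p⊆p∪q B (S⊆A (q⊆p∪q ⁅ x ⁆ (D ─ B) (x∈p∧x∉q⇒x∈p─q e∈D e∉B)))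
      A∉ : A ∉ Fs
      A∉ A∈F = forbid (A ∪ B) A∈F B∈ D∈ (λ { refl → x∉B x∈A }) A≢D (D≢B ∘ sym)
                 (p⊆p∪q B) (q⊆p∪q A B) D⊆A∪B
                 (≤-trans (∣p∪q∣≤ A B) (≤-reflexive (cong₂ _+_ ∣A∣≡k (size B∈))))
                 (λ e∈A e∈B _ → x∈∁p⇒x∉p (A⊆∁B e∈A) e∈B)
        where
        A≢D : A ≢ D
        A≢D refl = <-irrefl refl (≤-trans s<k (≤-trans (≤-reflexive (sym ∣A∣≡k))
                     (p⊆q⇒∣p∣≤∣q∣ (λ e∈A → q⊆p∪q ⁅ x ⁆ (A ─ B) (x∈p∧x∉q⇒x∈p─q e∈A (x∈∁p⇒x∉p (A⊆∁B e∈A)))))))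

  -- Double counting of pairs with `D ⊆ A ∪ B`: a near `D` occurs with at least n - 2k missing sets
  -- `A`, and for each missing `A` the 2k points of `A ∪ B` span at most C(2k, k) members.
  near-bound : suc d * #near ≤ ((2 * k) C k) * length missing
  near-bound = begin
    suc d * #near                                              ≡⟨ *-comm (suc d) #near ⟩
    #near * suc d                                              ≡⟨ sym (∑-*ʳ Fs (λ D → ⟦ near? D ⟧) (suc d)) ⟩
    ∑ Fs (λ D → ⟦ near? D ⟧ * suc d)                           ≤⟨ ∑-mono Fs (λ {D} D∈ → kills D∈ (near? D)) ⟩
    ∑ Fs (λ D → ∑ missing (λ A → ⟦ D ⊆? A ∪ B ⟧))              ≡⟨ ∑-swap Fs missing (λ D A → ⟦ D ⊆? A ∪ B ⟧) ⟩
    ∑ missing (λ A → ∑ Fs (λ D → ⟦ D ⊆? A ∪ B ⟧))              ≤⟨ ∑-mono missing killed-by ⟩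
    ∑ missing (λ _ → (2 * k) C k)                              ≡⟨ ∑-const missing ((2 * k) C k) ⟩
    length missing * ((2 * k) C k)                             ≡⟨ *-comm (length missing) ((2 * k) C k) ⟩
    ((2 * k) C k) * length missing                             ∎
    where
    open ≤-Reasoning
    kills : ∀ {D} → D ∈ Fs → (p : Dec (Near D)) → ⟦ p ⟧ * suc d ≤ ∑ missing (λ A → ⟦ D ⊆? A ∪ B ⟧)
    kills D∈ (yes p) = ≤-trans (≤-reflexive (*-identityˡ (suc d))) (near-kills D∈ p)
    kills D∈ (no _)  = z≤n
    killed-by : ∀ {A} → A ∈ missing → ∑ Fs (λ D → ⟦ D ⊆? A ∪ B ⟧) ≤ (2 * k) C k
    killed-by {A} A∈ with missing⁻ A∈
    ... | x∈A , A⊆∁B , ∣A∣ , _ = begin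
      ∑ Fs (λ D → ⟦ D ⊆? A ∪ B ⟧)
        ≤⟨ count≤length (λ D → D ⊆? A ∪ B) (distinct F) (λ D∈ D⊆ → ∈-interval⁺ (⊥⊆ {p = _}) D⊆ (size D∈)) ⟩
      length (interval ⊥ (A ∪ B) k)
        ≡⟨ cong (λ s → length (interval ⊥ (A ∪ B) (s + k))) (sym (∣⊥∣≡0 n)) ⟩
      length (interval ⊥ (A ∪ B) (∣ ⊥ {n} ∣ + k))
        ≡⟨ length-interval ⊥ (A ∪ B) k (⊥⊆ {p = A ∪ B}) (trans ∣A∪B∣ (cong (_+ 2 * k) (sym (∣⊥∣≡0 n)))) ⟩
      (2 * k) C k ∎
      where
      ∣A∪B∣ : ∣ A ∪ B ∣ ≡ 2 * k
      ∣A∪B∣ = trans (∣p∪q∣-disjoint A B (λ e∈A → x∈∁p⇒x∉p (A⊆∁B e∈A)))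
                (trans (cong₂ _+_ ∣A∣ (size B∈)) (cong (k +_) (sym (+-identityʳ k))))

  -- Far members: cores, holes and codes

  far⇒⊆T : ∀ {D} → D ∈ Fs → Far D → D ─ B ⊆ˢ T
  far⇒⊆T {D} D∈ (x∉D , _) e∈ = let e∈D , e∉B = ∈─⁻ {p = D} e∈ in
    ∈T⁺ (λ { refl → x∉D e∈D }) e∉B (avoids-N D∈ x∉D e∈D)

  -- A core consists of k - 2 leaves of `x`; together with `x` and a point of `T` it forms a
  -- candidate.
  cores : List (Subset n)
  cores = interval ⊥ N (1 + j)

  extend : Fin n → Subset n → Subset n
  extend c R = ⁅ x ⁆ ∪ (⁅ c ⁆ ∪ R)

  ∈extend⁻ : ∀ {c R e} → e ∈ˢ extend c R → e ≡ x ⊎ e ≡ c ⊎ e ∈ˢ R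
  ∈extend⁻ e∈ with ∈⁅⁆∪⁻ e∈
  ... | inj₁ e≡x = inj₁ e≡x
  ... | inj₂ e∈′ = inj₂ (∈⁅⁆∪⁻ e∈′)

  x∈extend : ∀ c R → x ∈ˢ extend c R
  x∈extend c R = x∈⁅x⁆∪p (⁅ c ⁆ ∪ R) x

  c∈extend : ∀ c R → c ∈ˢ extend c R
  c∈extend c R = q⊆p∪q ⁅ x ⁆ (⁅ c ⁆ ∪ R) (x∈⁅x⁆∪p R c)

  core⁻ : ∀ {R} → R ∈ cores → R ⊆ˢ N × ∣ R ∣ ≡ 1 + j
  core⁻ {R} R∈ = proj₂ (∈-interval⁻ {S = ⊥} {X = N} {A = R} R∈)

  Hole : Subset n → Fin n → Set
  Hole R c = c ∈ˢ T × extend c R ∉ Fs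

  hole? : ∀ R c → Dec (Hole R c)
  hole? R c = (c ∈? T) ×-dec ¬? (member? (extend c R))

  holes : Subset n → Subset n
  holes R = comprehension (hole? R)

  holes⊆T : ∀ {R c} → c ∈ˢ holes R → c ∈ˢ T
  holes⊆T {R} c∈ = proj₁ (∈-comprehension⁻ (hole? R) c∈)

  -- If both extensions were members, their common part {x} ∪ R would be disjoint from `D`, which
  -- avoids `x` and so all leaves. The three sets lie in D ∪ {x} ∪ R, which has at most 2k - 1
  -- points.
  one-of-two-is-hole : ∀ {D R c c′} → D ∈ Fs → Far D → R ∈ cores → c ∈ˢ D ─ B → c′ ∈ˢ D ─ B → c ≢ c′ →
                       c ∈ˢ holes R ⊎ c′ ∈ˢ holes R
  one-of-two-is-hole {D} {R} {c} {c′} D∈ far@(x∉D , _) R∈ c∈ c′∈ c≢c′ with member? (extend c R) | member? (extend c′ R)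
  ... | no ∉F   | _        = inj₁ (∈-comprehension⁺ (hole? R) (far⇒⊆T D∈ far c∈ , ∉F))
  ... | yes _   | no ∉F    = inj₂ (∈-comprehension⁺ (hole? R) (far⇒⊆T D∈ far c′∈ , ∉F))
  ... | yes A∈  | yes A′∈  = ⊥-elim (forbid (D ∪ (⁅ x ⁆ ∪ R)) A∈ A′∈ D∈
          (λ eq → c∉A′ (subst (c ∈ˢ_) eq (c∈extend c R)))
          (λ eq → x∉D (subst (x ∈ˢ_) eq (x∈extend c R)))
          (λ eq → x∉D (subst (x ∈ˢ_) eq (x∈extend c′ R)))
          (extend⊆ c∈D) (extend⊆ (proj₁ (∈─⁻ {p = D} c′∈))) (p⊆p∪q (⁅ x ⁆ ∪ R)) ∣X∣≤ disj)
    where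
    c∈D = proj₁ (∈─⁻ {p = D} c∈)
    R∌ : ∀ {e} → e ∈ˢ D → e ∉ˢ R
    R∌ e∈D e∈R = avoids-N D∈ x∉D e∈D (proj₁ (core⁻ R∈) e∈R)
    c∉A′ : c ∉ˢ extend c′ R
    c∉A′ c∈A′ with ∈extend⁻ c∈A′
    ... | inj₁ refl        = x∉D c∈D
    ... | inj₂ (inj₁ c≡c′) = c≢c′ c≡c′
    ... | inj₂ (inj₂ c∈R)  = R∌ c∈D c∈R
    extend⊆ : ∀ {e} → e ∈ˢ D → extend e R ⊆ˢ D ∪ (⁅ x ⁆ ∪ R)
    extend⊆ e∈D y∈ with ∈extend⁻ y∈
    ... | inj₁ refl        = q⊆p∪q D (⁅ x ⁆ ∪ R) (x∈⁅x⁆∪p R x)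
    ... | inj₂ (inj₁ refl) = p⊆p∪q (⁅ x ⁆ ∪ R) e∈D
    ... | inj₂ (inj₂ y∈R)  = q⊆p∪q D (⁅ x ⁆ ∪ R) (q⊆p∪q ⁅ x ⁆ R y∈R)
    ∣X∣≤ : ∣ D ∪ (⁅ x ⁆ ∪ R) ∣ ≤ k + k
    ∣X∣≤ = ≤-trans (∣p∪q∣≤ D (⁅ x ⁆ ∪ R)) (+-mono-≤ (≤-reflexive (size D∈))
             (≤-trans (∣p∪q∣≤ ⁅ x ⁆ R) (≤-trans (≤-reflexive (cong₂ _+_ (∣⁅x⁆∣≡1 x) (proj₂ (core⁻ R∈)))) (n≤1+n _))))
    disj : ∀ {y} → y ∈ˢ extend c R → y ∈ˢ extend c′ R → y ∉ˢ D
    disj y∈ y∈′ y∈D with ∈extend⁻ y∈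
    ... | inj₁ refl        = x∉D y∈D
    ... | inj₂ (inj₁ refl) = c∉A′ y∈′
    ... | inj₂ (inj₂ y∈R)  = R∌ y∈D y∈R

  meets-holes : ∀ {D R} (P : Subset n) → D ∈ Fs → Far D → R ∈ cores → P ⊆ˢ D ─ B → 2 ≤ ∣ P ∣ →
                ∃[ c ] c ∈ˢ P × c ∈ˢ holes R
  meets-holes P D∈ far R∈ P⊆ 2≤ with nonempty {p = P} (≤-trans (s≤s z≤n) 2≤)
  ... | c , c∈ with another {p = P} c 2≤
  ...   | c′ , c′∈ , c′≢c with one-of-two-is-hole D∈ far R∈ (P⊆ c∈) (P⊆ c′∈) (c′≢c ∘ sym)
  ...     | inj₁ h = c , c∈ , h
  ...     | inj₂ h = c′ , c′∈ , h

  -- A facet-like label: among far members only `D` contains `P`. Uniqueness is asked for among far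
  -- members alone, which is weaker than `Private` and suffices for counting them.
  Code : Subset n → Subset n → Set
  Code P D = Far D × P ⊆ˢ D × All (λ D′ → Far D′ → P ⊆ˢ D′ → D′ ≡ D) Fs

  code? : ∀ P D → Dec (Code P D)
  code? P D = far? D ×-dec (P ⊆? D) ×-dec All.all? (λ D′ → far? D′ →-dec ((P ⊆? D′) →-dec (D′ ≟ˢ D))) Fs

  Coded : Subset n → Set
  Coded D = Any (λ P → Code P D) (interval ⊥ T (2 + j))

  coded? : ∀ D → Dec (Coded D)
  coded? D = Any.any? (λ P → code? P D) (interval ⊥ T (2 + j))

  Stray : Subset n → Set
  Stray D = Far D × ¬ Coded D

  stray? : ∀ D → Dec (Stray D)
  stray? D = far? D ×-dec ¬? (coded? D)

  -- Such a `D` has exactly one point `e` in `B`, and `P = D ─ B` is a code. Another member `D′`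
  -- containing `P` misses `e`, since otherwise `D′ ≡ D`; then `D`, `D′`, `B` have no common point
  -- and lie in `D′ ∪ B`.
  meets-B⇒coded : ∀ {D} → D ∈ Fs → Far D → Nonempty (D ∩ B) → Coded D
  meets-B⇒coded {D} D∈ far@(x∉D , 2+j≤) ne =
    lose (∈-interval⁺ {A = P} (⊥⊆ {p = P}) (far⇒⊆T D∈ far) ∣P∣)
         (far , p─q⊆p D B , All.tabulate λ D′∈ _ P⊆D′ → same D′∈ (λ {y} → P⊆D′ {y}))
    where
    P = D ─ B
    ∣P∣ : ∣ P ∣ ≡ 2 + j
    ∣P∣ = ≤-antisym (≤-pred (≤-trans (p∩q≢∅⇒∣p─q∣<∣p∣ D B ne) (≤-reflexive (size D∈)))) 2+j≤
    same : ∀ {D′} → D′ ∈ Fs → P ⊆ˢ D′ → D′ ≡ D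
    same {D′} D′∈ P⊆D′ with D′ ≟ˢ D
    ... | yes eq = eq
    ... | no neq = ⊥-elim (forbid (D′ ∪ B) D∈ D′∈ B∈ (neq ∘ sym) (λ eq → c∉B (subst (c ∈ˢ_) eq c∈D)) (λ eq → c∉B (subst (c ∈ˢ_) eq (P⊆D′ c∈P)))
            D⊆D′∪B (p⊆p∪q B) (q⊆p∪q D′ B) (≤-trans (∣p∪q∣≤ D′ B) (≤-reflexive (cong₂ _+_ (size D′∈) (size B∈)))) disj)
      where
      P≠∅ = nonempty {p = P} (≤-trans (s≤s z≤n) 2+j≤)
      c = proj₁ P≠∅
      c∈P = proj₂ P≠∅
      c∈D = proj₁ (∈─⁻ {p = D} c∈P)
      c∉B = proj₂ (∈─⁻ {p = D} c∈P)
      D⊆D′∪B : D ⊆ˢ D′ ∪ B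
      D⊆D′∪B {e} e∈D with e ∈? B
      ... | yes e∈B = q⊆p∪q D′ B e∈B
      ... | no  e∉B = p⊆p∪q B (P⊆D′ (x∈p∧x∉q⇒x∈p─q e∈D e∉B))
      disj : ∀ {e} → e ∈ˢ D → e ∈ˢ D′ → e ∉ˢ B
      disj {e} e∈D e∈D′ e∈B = neq (sym (⊆⇒≡ D∈ D′∈ (subst (_⊆ˢ D′) e∪P≡D (∪⊆ {p = ⁅ e ⁆} (⁅⁆⊆ e∈D′) (λ {y} → P⊆D′ {y})))))
        where
        e∪P≡D : ⁅ e ⁆ ∪ P ≡ D
        e∪P≡D = ⊆∧∣∣≡⇒≡ (∪⊆ {p = ⁅ e ⁆} (⁅⁆⊆ e∈D) (p─q⊆p D B))
                  (trans (∣⁅x⁆∪p∣ λ e∈P → proj₂ (∈─⁻ {p = D} e∈P) e∈B) (trans (cong suc ∣P∣) (sym (size D∈))))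

  stray⇒⊆T : ∀ {D} → D ∈ Fs → Stray D → D ⊆ˢ T
  stray⇒⊆T {D} D∈ (far@(x∉D , _) , ¬coded) {e} e∈D =
    ∈T⁺ (λ { refl → x∉D e∈D }) (λ e∈B → ¬coded (meets-B⇒coded D∈ far (e , x∈p∩q⁺ (e∈D , e∈B)))) (avoids-N D∈ x∉D e∈D)

  -- A stray member lies inside `T`, so any private facet of it would be a code. This makes
  -- `shared-meets-twice` available at every point of `D`.
  stray⇒shared : ∀ {D c} → D ∈ Fs → Stray D → c ∈ˢ D → Shared c D
  stray⇒shared {D} {c} D∈ stray@(far , ¬coded) c∈D = c∈D , λ priv → ¬coded
    (lose (∈-interval⁺ {A = D - c} (⊥⊆ {p = D - c}) (λ e∈ → stray⇒⊆T D∈ stray (p-x⊆p D c e∈)) (cong pred (trans (∣p-x∣ c∈D) (size D∈))))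
          (far , p-x⊆p D c , All.map (λ imp _ → imp) priv))

  CodedAt : Fin n → Subset n → Set
  CodedAt c D = Any (λ P → Code P D) (interval ⁅ c ⁆ T (2 + j))

  codedAt? : ∀ c D → Dec (CodedAt c D)
  codedAt? c D = Any.any? (λ P → code? P D) (interval ⁅ c ⁆ T (2 + j))

  #codedAt : ∀ {c} → c ∈ˢ T → ∑ Fs (λ D → ⟦ codedAt? c D ⟧) ≤ ∣ T ∣ C (1 + j)
  #codedAt {c} c∈T = begin
    ∑ Fs (λ D → ⟦ codedAt? c D ⟧)
      ≤⟨ ∑-cover (codedAt? c) (λ D P → code? P D) Fs (interval ⁅ c ⁆ T (2 + j)) (λ _ → find)
           (λ {P} _ → ∑-unique (λ D → ⟦ code? P D ⟧) (distinct F) (λ {D} _ → ⟦⟧≤ (code? P D) λ _ → ≤-refl)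
             λ {D} {D′} D∈ _ p q → let far , P⊆D , _ = ⟦⟧⁻ (code? P D) p
                                       _ , _ , only = ⟦⟧⁻ (code? P D′) q
                                   in All.lookup only D∈ far P⊆D) ⟩
    length (interval ⁅ c ⁆ T (2 + j)) * 1
      ≡⟨ trans (*-identityʳ _) (cong (λ s → length (interval ⁅ c ⁆ T (s + (1 + j)))) (sym (∣⁅x⁆∣≡1 c))) ⟩
    length (interval ⁅ c ⁆ T (∣ ⁅ c ⁆ ∣ + (1 + j)))
      ≤⟨ interval-length≤ ⁅ c ⁆ T (1 + j) (⁅⁆⊆ c∈T) ⟩
    ∣ T ∣ C (1 + j) ∎
    where open ≤-Reasoning

  -- A code has k - 1 ≥ 2 points in D - B and therefore contains a hole of `R`. The codes through
  -- that point number at most C(∣T∣, k - 2), and each determines its member.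
  #coded : ∀ {R} → R ∈ cores → ∑ Fs (λ D → ⟦ coded? D ⟧) ≤ ∣ holes R ∣ * (∣ T ∣ C (1 + j))
  #coded {R} R∈ = subst (λ h → ∑ Fs (λ D → ⟦ coded? D ⟧) ≤ h * (∣ T ∣ C (1 + j))) (length-elems (holes R))
    (∑-cover coded? (λ D c → codedAt? c D) Fs (elems (holes R)) locate (λ c∈ → #codedAt (holes⊆T {R} (∈-elems⁻ c∈))))
    where
    locate : ∀ {D} → D ∈ Fs → Coded D → ∃[ c ] c ∈ elems (holes R) × CodedAt c D
    locate {D} D∈ coded with find coded
    ... | P , P∈ , code@(far , P⊆D , _) with ∈-interval⁻ {S = ⊥} {X = T} {A = P} P∈
    ...   | _ , P⊆T , ∣P∣ with meets-holes P D∈ far R∈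
                                 (λ e∈P → x∈p∧x∉q⇒x∈p─q (P⊆D e∈P) (proj₁ (proj₂ (∈T⁻ (P⊆T e∈P)))))
                                 (≤-trans (m≤m+n 2 j) (≤-reflexive (sym ∣P∣)))
    ...     | c , c∈P , c∈h = c , ∈-elems⁺ c∈h , lose (∈-interval⁺ (⁅⁆⊆ c∈P) P⊆T ∣P∣) code

  -- Fix one stray `D₀` through `p`. Every stray member through `p` shares a second point `q` with
  -- it, for which there are k - 1 choices, and lies in `T`.
  #strayAt : ∀ p → ∑ Fs (λ D → ⟦ stray? D ×-dec (p ∈? D) ⟧) ≤ (2 + j) * (∣ T ∣ C (1 + j))
  #strayAt p with Any.any? (λ D → stray? D ×-dec (p ∈? D)) Fs
  ... | no none = ≤-trans (∑-zero Fs _ λ {D} D∈ 1≤ → none (lose D∈ (⟦⟧⁻ (stray? D ×-dec (p ∈? D)) 1≤))) z≤n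
  ... | yes some with find some
  ...   | D₀ , D₀∈ , stray₀ , p∈D₀ =
    subst (λ h → ∑ Fs (λ D → ⟦ stray? D ×-dec (p ∈? D) ⟧) ≤ h * (∣ T ∣ C (1 + j)))
      (trans (length-elems (D₀ - p)) (cong pred (trans (∣p-x∣ p∈D₀) (size D₀∈))))
      (∑-cover (λ D → stray? D ×-dec (p ∈? D)) (λ D q → stray? D ×-dec (p ∈? D) ×-dec (q ∈? D)) Fs (elems (D₀ - p))
        (λ {D} D∈ (stray , p∈D) →
           let q , q∈D , q∈D₀ , q≢p = shared-meets-twice {D} {D₀} {p} D∈ (stray⇒shared {D} {p} D∈ stray p∈D) D₀∈ p∈D₀
           in q , ∈-elems⁺ (x∈p∧x≢y⇒x∈p-y q∈D₀ q≢p) , stray , p∈D , q∈D)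
        (λ {q} q∈ → pair-degree (λ { refl → x∉p-x {p = D₀} (∈-elems⁻ q∈) })
                      (stray⇒⊆T D₀∈ stray₀ (p-x⊆p D₀ p (∈-elems⁻ q∈)))))
    where
    pair-degree : ∀ {q} → p ≢ q → q ∈ˢ T → ∑ Fs (λ D → ⟦ stray? D ×-dec (p ∈? D) ×-dec (q ∈? D) ⟧) ≤ ∣ T ∣ C (1 + j)
    pair-degree {q} p≢q q∈T = begin
      ∑ Fs (λ D → ⟦ stray? D ×-dec (p ∈? D) ×-dec (q ∈? D) ⟧)
        ≤⟨ count≤length (λ D → stray? D ×-dec (p ∈? D) ×-dec (q ∈? D)) (distinct F)
             (λ D∈ (stray , p∈ , q∈) → ∈-interval⁺ (∪⊆ {p = ⁅ p ⁆} (⁅⁆⊆ p∈) (⁅⁆⊆ q∈)) (stray⇒⊆T D∈ stray) (size D∈)) ⟩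
      length (interval (⁅ p ⁆ ∪ ⁅ q ⁆) T (2 + (1 + j)))
        ≡⟨ cong (λ s → length (interval (⁅ p ⁆ ∪ ⁅ q ⁆) T (s + (1 + j)))) (sym (∣pair∣ p≢q)) ⟩
      length (interval (⁅ p ⁆ ∪ ⁅ q ⁆) T (∣ ⁅ p ⁆ ∪ ⁅ q ⁆ ∣ + (1 + j)))
        ≤⟨ interval-length≤ (⁅ p ⁆ ∪ ⁅ q ⁆) T (1 + j) (∪⊆ {p = ⁅ p ⁆} (⁅⁆⊆ (stray⇒⊆T D₀∈ stray₀ p∈D₀)) (⁅⁆⊆ q∈T)) ⟩
      ∣ T ∣ C (1 + j) ∎
      where open ≤-Reasoning

  #stray : ∀ {R} → R ∈ cores → ∑ Fs (λ D → ⟦ stray? D ⟧) ≤ ∣ holes R ∣ * ((2 + j) * (∣ T ∣ C (1 + j)))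
  #stray {R} R∈ = subst (λ h → ∑ Fs (λ D → ⟦ stray? D ⟧) ≤ h * ((2 + j) * (∣ T ∣ C (1 + j)))) (length-elems (holes R))
    (∑-cover stray? (λ D p → stray? D ×-dec (p ∈? D)) Fs (elems (holes R)) locate (λ {p} _ → #strayAt p))
    where
    locate : ∀ {D} → D ∈ Fs → Stray D → ∃[ p ] p ∈ elems (holes R) × Stray D × p ∈ˢ D
    locate {D} D∈ stray@(far , _) with meets-holes (D ─ B) D∈ far R∈ id (≤-trans (m≤m+n 2 j) (proj₂ far))
    ... | p , p∈ , p∈h = p , ∈-elems⁺ p∈h , stray , p─q⊆p D B p∈

  #far≤ : ∀ {R} → R ∈ cores → #far ≤ ∣ holes R ∣ * (k * (∣ T ∣ C (1 + j)))
  #far≤ {R} R∈ = begin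
    #far
      ≤⟨ ∑-mono Fs (λ {D} _ → ⟦⟧≤ (far? D) λ far → coded-or-stray far (coded? D)) ⟩
    ∑ Fs (λ D → ⟦ coded? D ⟧ + ⟦ stray? D ⟧)
      ≡⟨ ∑-distrib-+ Fs (λ D → ⟦ coded? D ⟧) (λ D → ⟦ stray? D ⟧) ⟩
    ∑ Fs (λ D → ⟦ coded? D ⟧) + ∑ Fs (λ D → ⟦ stray? D ⟧)
      ≤⟨ +-mono-≤ (#coded R∈) (#stray R∈) ⟩
    ∣ holes R ∣ * (∣ T ∣ C (1 + j)) + ∣ holes R ∣ * ((2 + j) * (∣ T ∣ C (1 + j)))
      ≡⟨ sym (*-distribˡ-+ ∣ holes R ∣ (∣ T ∣ C (1 + j)) _) ⟩
    ∣ holes R ∣ * (k * (∣ T ∣ C (1 + j))) ∎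
    where
    open ≤-Reasoning
    coded-or-stray : ∀ {D} → Far D → Dec (Coded D) → 1 ≤ ⟦ coded? D ⟧ + ⟦ stray? D ⟧
    coded-or-stray {D} far (yes c) = ≤-trans (⟦⟧-yes (coded? D) c) (m≤m+n _ _)
    coded-or-stray {D} far (no ¬c) = ≤-trans (⟦⟧-yes (stray? D) (far , ¬c)) (m≤n+m _ ⟦ coded? D ⟧)

  Extends : Subset n → Subset n → Fin n → Set
  Extends A R c = Hole R c × extend c R ≡ A

  extends? : ∀ A R c → Dec (Extends A R c)
  extends? A R c = hole? R c ×-dec (extend c R ≟ˢ A)

  -- `x`, `N` and `T` are disjoint, so `R` and `c` can be read off the extended set as its parts in
  -- `N` and `T`.
  extend-injective : ∀ {R R′ c c′} → R ∈ cores → R′ ∈ cores → c ∈ˢ T → c′ ∈ˢ T → extend c R ≡ extend c′ R′ → R ≡ R′ × c ≡ c′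
  extend-injective {R} {R′} {c} {c′} R∈ R′∈ c∈T c′∈T eq =
    ⊆∧∣∣≡⇒≡ R⊆R′ (trans (proj₂ (core⁻ R∈)) (sym (proj₂ (core⁻ R′∈)))) , c≡c′
    where
    R⊆R′ : R ⊆ˢ R′
    R⊆R′ {e} e∈R with proj₁ (core⁻ R∈) e∈R | ∈extend⁻ (subst (e ∈ˢ_) eq (q⊆p∪q ⁅ x ⁆ (⁅ c ⁆ ∪ R) (q⊆p∪q ⁅ c ⁆ R e∈R)))
    ... | e∈N | inj₁ refl        = ⊥-elim (z∉leaves e∈N)
    ... | e∈N | inj₂ (inj₁ refl) = ⊥-elim (proj₂ (proj₂ (∈T⁻ c′∈T)) e∈N)
    ... | _   | inj₂ (inj₂ e∈R′) = e∈R′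
    c≡c′ : c ≡ c′
    c≡c′ with ∈extend⁻ (subst (c ∈ˢ_) eq (c∈extend c R))
    ... | inj₁ c≡x         = ⊥-elim (proj₁ (∈T⁻ c∈T) c≡x)
    ... | inj₂ (inj₁ c≡c′) = c≡c′
    ... | inj₂ (inj₂ c∈R′) = ⊥-elim (proj₂ (proj₂ (∈T⁻ c∈T)) (proj₁ (core⁻ R′∈) c∈R′))

  hole⇒missing : ∀ {R c} → R ∈ cores → Hole R c → extend c R ∈ missing
  hole⇒missing {R} {c} R∈ (c∈T , ∉F) = missing⁺ (x∈extend c R) ⊆∁B ∣ext∣ ∉F
    where
    c∉B = proj₁ (proj₂ (∈T⁻ c∈T))
    c∉R : c ∉ˢ R
    c∉R c∈R = proj₂ (proj₂ (∈T⁻ c∈T)) (proj₁ (core⁻ R∈) c∈R)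
    x∉ : x ∉ˢ ⁅ c ⁆ ∪ R
    x∉ x∈ = [ (λ x≡c → proj₁ (∈T⁻ c∈T) (sym x≡c)) , (λ x∈R → z∉leaves (proj₁ (core⁻ R∈) x∈R)) ]′ (∈⁅⁆∪⁻ x∈)
    ⊆∁B : extend c R ⊆ˢ ∁ B
    ⊆∁B e∈ with ∈extend⁻ e∈
    ... | inj₁ refl        = x∉p⇒x∈∁p x∉B
    ... | inj₂ (inj₁ refl) = x∉p⇒x∈∁p c∉B
    ... | inj₂ (inj₂ e∈R)  = x∉p⇒x∈∁p λ e∈B → avoids-N B∈ x∉B e∈B (proj₁ (core⁻ R∈) e∈R)
    ∣ext∣ : ∣ extend c R ∣ ≡ k
    ∣ext∣ = trans (∣⁅x⁆∪p∣ x∉) (cong suc (trans (∣⁅x⁆∪p∣ c∉R) (cong suc (proj₂ (core⁻ R∈)))))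

  -- The pairs of a core and one of its holes inject into the missing sets by `extend`; the
  -- intermediate sums over `extends?` carry out this injection.
  ∑∣holes∣ : ∑ cores (λ R → ∣ holes R ∣) ≤ length missing
  ∑∣holes∣ = begin
    ∑ cores (λ R → ∣ holes R ∣)
      ≤⟨ ∑-mono cores (λ {R} R∈ → ≤-trans (≤-reflexive (sym (length-elems (holes R))))
           (length≤count (hole? R) (elems-unique (holes R)) λ c∈ → ∈-allFin _ , ∈-comprehension⁻ (hole? R) (∈-elems⁻ c∈))) ⟩
    ∑ cores (λ R → ∑ (allFin n) (λ c → ⟦ hole? R c ⟧))
      ≤⟨ ∑-mono cores (λ {R} R∈ → ∑-mono (allFin n) λ {c} _ → ⟦⟧≤ (hole? R c) λ h →
           ≤-trans (⟦⟧-yes (extends? (extend c R) R c) (h , refl)) (∑-≥ (λ A → ⟦ extends? A R c ⟧) (hole⇒missing R∈ h))) ⟩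
    ∑ cores (λ R → ∑ (allFin n) (λ c → ∑ missing (λ A → ⟦ extends? A R c ⟧)))
      ≡⟨ cong sum (map-cong (λ R → ∑-swap (allFin n) missing (λ c A → ⟦ extends? A R c ⟧)) cores) ⟩
    ∑ cores (λ R → ∑ missing (λ A → ∑ (allFin n) (λ c → ⟦ extends? A R c ⟧)))
      ≡⟨ ∑-swap cores missing (λ R A → ∑ (allFin n) (λ c → ⟦ extends? A R c ⟧)) ⟩
    ∑ missing (λ A → ∑ cores (λ R → ∑ (allFin n) (λ c → ⟦ extends? A R c ⟧)))
      ≤⟨ ∑-mono missing (λ {A} _ → ∑-unique _ (interval-unique ⊥ N (1 + j)) (one-point A) (one-core A)) ⟩
    ∑ missing (λ _ → 1)   ≡⟨ ∑-1 missing ⟩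
    length missing        ∎
    where
    open ≤-Reasoning
    one-point : ∀ A {R} → R ∈ cores → ∑ (allFin n) (λ c → ⟦ extends? A R c ⟧) ≤ 1
    one-point A {R} R∈ = ∑-unique _ (Uniqueₚ.allFin⁺ n) (λ {c} _ → ⟦⟧≤ (extends? A R c) λ _ → ≤-refl)
      λ {c} {c′} _ _ p q → let (c∈T , _) , eq = ⟦⟧⁻ (extends? A R c) p
                               (c′∈T , _) , eq′ = ⟦⟧⁻ (extends? A R c′) q
                           in proj₂ (extend-injective R∈ R∈ c∈T c′∈T (trans eq (sym eq′)))
    one-core : ∀ A {R R′} → R ∈ cores → R′ ∈ cores → 1 ≤ ∑ (allFin n) (λ c → ⟦ extends? A R c ⟧) →
               1 ≤ ∑ (allFin n) (λ c → ⟦ extends? A R′ c ⟧) → R ≡ R′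
    one-core A {R} {R′} R∈ R′∈ p q with ∑-witness (allFin n) (λ c → ⟦ extends? A R c ⟧) p | ∑-witness (allFin n) (λ c → ⟦ extends? A R′ c ⟧) q
    ... | c , _ , p′ | c′ , _ , q′ = let (c∈T , _) , eq = ⟦⟧⁻ (extends? A R c) p′
                                         (c′∈T , _) , eq′ = ⟦⟧⁻ (extends? A R′ c′) q′
                                     in proj₁ (extend-injective R∈ R′∈ c∈T c′∈T (trans eq (sym eq′)))

  -- The bound `#far≤` is valid for every core, so it is added over all of them: a single core might
  -- have many holes, but the total is at most the number of missing sets.
  far-bound : (∣ N ∣ C (1 + j)) * #far ≤ (k * (∣ T ∣ C (1 + j))) * length missing
  far-bound = begin
    (∣ N ∣ C (1 + j)) * #far           ≡⟨ cong (_* #far) (sym length-cores) ⟩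
    length cores * #far                ≡⟨ sym (∑-const cores #far) ⟩
    ∑ cores (λ _ → #far)               ≤⟨ ∑-mono cores #far≤ ⟩
    ∑ cores (λ R → ∣ holes R ∣ * w)    ≡⟨ ∑-*ʳ cores (λ R → ∣ holes R ∣) w ⟩
    ∑ cores (λ R → ∣ holes R ∣) * w    ≤⟨ *-monoˡ-≤ w ∑∣holes∣ ⟩
    length missing * w                 ≡⟨ *-comm (length missing) w ⟩
    w * length missing                 ∎
    where
    open ≤-Reasoning
    w = k * (∣ T ∣ C (1 + j))
    length-cores : length cores ≡ ∣ N ∣ C (1 + j)
    length-cores = trans (cong (λ s → length (interval ⊥ N (s + (1 + j)))) (sym (∣⊥∣≡0 n)))
      (length-interval ⊥ N (1 + j) (⊥⊆ {p = N}) (cong (_+ ∣ N ∣) (sym (∣⊥∣≡0 n))))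

  -- The count in the dominant case

  #apart : ∑ Fs (λ D → ⟦ apart? D ⟧) + length missing ≤ m₀ C (2 + j)
  #apart = begin
    ∑ Fs (λ D → ⟦ apart? D ⟧) + length missing
      ≤⟨ +-monoˡ-≤ (length missing) (count-⊆ apart? member? (distinct F)
           λ D∈ (x∈D , D⊆∁B) → ∈-interval⁺ (⁅⁆⊆ x∈D) D⊆∁B (size D∈) , D∈) ⟩
    ∑ candidates (λ A → ⟦ member? A ⟧) + length missing   ≡⟨ length-filter-¬ candidates member? ⟩
    length candidates                                     ≡⟨ length-candidates ⟩
    m₀ C (2 + j)                                          ∎
    where open ≤-Reasoning

  card≤ : card F ≤ ∑ Fs (λ D → ⟦ apart? D ⟧) + (1 + (#near + #far))
  card≤ = begin
    length Fs          ≡⟨ sym (∑-1 Fs) ⟩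
    ∑ Fs (λ _ → 1)     ≤⟨ ∑-mono Fs (λ {D} D∈ → weight D (classify D∈)) ⟩
    ∑ Fs (λ D → ⟦ apart? D ⟧ + (⟦ D ≟ˢ B ⟧ + (⟦ near? D ⟧ + ⟦ far? D ⟧)))
      ≡⟨ trans (∑-distrib-+ Fs _ _) (cong (∑ Fs (λ D → ⟦ apart? D ⟧) +_) (trans (∑-distrib-+ Fs _ _)
           (cong (∑ Fs (λ D → ⟦ D ≟ˢ B ⟧) +_) (∑-distrib-+ Fs _ _)))) ⟩
    ∑ Fs (λ D → ⟦ apart? D ⟧) + (∑ Fs (λ D → ⟦ D ≟ˢ B ⟧) + (#near + #far))
      ≤⟨ +-monoʳ-≤ (∑ Fs (λ D → ⟦ apart? D ⟧)) (+-monoˡ-≤ (#near + #far)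
           (∑-unique _ (distinct F) (λ {D} _ → ⟦⟧≤ (D ≟ˢ B) λ _ → ≤-refl)
             λ {D} {D′} _ _ p q → trans (⟦⟧⁻ (D ≟ˢ B) p) (sym (⟦⟧⁻ (D′ ≟ˢ B) q)))) ⟩
    ∑ Fs (λ D → ⟦ apart? D ⟧) + (1 + (#near + #far)) ∎
    where
    open ≤-Reasoning
    weight : ∀ D → Apart D ⊎ D ≡ B ⊎ Near D ⊎ Far D → 1 ≤ ⟦ apart? D ⟧ + (⟦ D ≟ˢ B ⟧ + (⟦ near? D ⟧ + ⟦ far? D ⟧))
    weight D (inj₁ p)                = ≤-trans (⟦⟧-yes (apart? D) p) (m≤m+n _ _)
    weight D (inj₂ (inj₁ p))         = ≤-trans (⟦⟧-yes (D ≟ˢ B) p) (≤-trans (m≤m+n _ _) (m≤n+m _ ⟦ apart? D ⟧))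
    weight D (inj₂ (inj₂ (inj₁ p)))  = ≤-trans (⟦⟧-yes (near? D) p) (≤-trans (m≤m+n _ _) (≤-trans (m≤n+m _ ⟦ D ≟ˢ B ⟧) (m≤n+m _ ⟦ apart? D ⟧)))
    weight D (inj₂ (inj₂ (inj₂ p)))  = ≤-trans (⟦⟧-yes (far? D) p) (≤-trans (m≤n+m _ ⟦ near? D ⟧) (≤-trans (m≤n+m _ ⟦ D ≟ˢ B ⟧) (m≤n+m _ ⟦ apart? D ⟧)))

  -- Near members cost at most a quarter of the missing candidates and far members at most three
  -- quarters. Together with the apart members they are thus no more than the candidates, and the
  -- final 1 is `B`.
  dominant-star-bound : 4 * ((2 * k) C k) ≤ suc d → 1 + j ≤ ∣ N ∣ → card F ≤ m₀ C (2 + j) + 1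
  dominant-star-bound 4C≤d 1+j≤∣N∣ = begin
    card F                                          ≤⟨ card≤ ⟩
    a + (1 + (#near + #far))                        ≡⟨ solve 2 (λ a b → a :+ (con 1 :+ b) := a :+ b :+ con 1) refl a (#near + #far) ⟩
    a + (#near + #far) + 1                          ≤⟨ +-monoˡ-≤ 1 (+-monoʳ-≤ a others≤) ⟩
    a + length missing + 1                          ≤⟨ +-monoˡ-≤ 1 #apart ⟩
    m₀ C (2 + j) + 1                                ∎
    where
    open ≤-Reasoning
    a = ∑ Fs (λ D → ⟦ apart? D ⟧)
    others≤ : #near + #far ≤ length missing
    others≤ = *-cancelˡ-≤ 4 (begin
      4 * (#near + #far)                            ≡⟨ *-distribˡ-+ 4 #near #far ⟩
      4 * #near + 4 * #far                          ≤⟨ +-mono-≤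
        (divide-out {#near} {(2 * k) C k} {1} (s≤s z≤n) near-bound (≤-trans 4C≤d (≤-reflexive (sym (*-identityˡ (suc d))))))
        (divide-out {#far} {k * (∣ T ∣ C (1 + j))} {3} (C≥1 {∣ N ∣} {1 + j} 1+j≤∣N∣) far-bound (C-quarter ∣ T ∣ ∣ N ∣ j 4∣T∣≤∣N∣)) ⟩
      1 * length missing + 3 * length missing       ≡⟨ solve 1 (λ m → con 1 :* m :+ con 3 :* m := con 4 :* m) refl (length missing) ⟩
      4 * length missing                            ∎)

-- Combining the two cases

private
  2k<n : ∀ k n → 3 ≤ k → 3 * k * ((2 * k) C k) ≤ n → k + k < n
  2k<n k n 3≤k n≥ = begin-strict
    k + k                           ≡⟨ cong (k +_) (sym (+-identityʳ k)) ⟩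
    2 * k                           <⟨ m<m+n (2 * k) (≤-trans (C≥1 {2 * k} {k} (m≤m+n k _)) (m≤m+n _ _)) ⟩
    2 * k + 4 * ((2 * k) C k)       ≤⟨ 2k+4C≤n k n 3≤k n≥ ⟩
    n                               ∎
    where open ≤-Reasoning

  n≡n∸k∸1+k+1 : ∀ k n → k < n → n ≡ n ∸ k ∸ 1 + suc k
  n≡n∸k∸1+k+1 k n k<n =
    sym (trans (cong (_+ suc k) (trans (∸-+-assoc n k 1) (cong (n ∸_) (+-comm k 1)))) (m∸n+n≡m k<n))

theorem1p10 : ∀ (k : ℕ) → k ≥ 3 →
    ∀ (n : ℕ) → n ≥ 3 * k * ((2 * k) C k) →
    ∀ (F : Family n k) →
    ConditionallyIntersecting 3 (2 * k) F →
    ¬ Intersecting F →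
    card F ≤ ((n ∸ k ∸ 1) C (k ∸ 1)) + 1
theorem1p10 1 (s≤s ())
theorem1p10 2 (s≤s (s≤s ()))
theorem1p10 (suc (suc (suc j))) 3≤k n n≥ F CI ¬int = split (Finₚ.any? (λ z → 4 * n <? 5 * ∣ leaves z ∣))
  where
  open Stars F CI using (leaves; no-large-star-bound)
  k = 3 + j
  n>2k = 2k<n k n 3≤k n≥
  k<n = ≤-trans (s≤s (m≤m+n k k)) n>2k
  n≡m₀+k+1 = n≡n∸k∸1+k+1 k n k<n

  n≡3+l : ∃[ l ] n ≡ 3 + l
  n≡3+l = let l , eq = m≤n⇒∃[o]m+o≡n (≤-trans (m≤m+n 3 (1 + j)) k<n) in l , sym eq

  -- Taken from the strict inequality 2k < n, so that n - 2k is `suc d`, as `m≤mC` wants it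
  -- positive.
  d = proj₁ (m≤n⇒∃[o]m+o≡n n>2k)

  n≡k+k+d : n ≡ k + (k + suc d)
  n≡k+k+d = trans (sym (proj₂ (m≤n⇒∃[o]m+o≡n n>2k))) (trans (sym (+-suc (k + k) d)) (+-assoc k k (suc d)))

  4C≤d : 4 * ((2 * k) C k) ≤ suc d
  4C≤d = +-cancelˡ-≤ (2 * k) _ _ (begin
    2 * k + 4 * ((2 * k) C k)   ≤⟨ 2k+4C≤n k n 3≤k n≥ ⟩
    n                           ≡⟨ n≡k+k+d ⟩
    k + (k + suc d)             ≡⟨ solve 2 (λ k d → k :+ (k :+ d) := con 2 :* k :+ d) refl k (suc d) ⟩
    2 * k + suc d               ∎)
    where open ≤-Reasoning

  -- This guarantees that cores exist, so that `far-bound` can be divided by their number.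
  many-leaves : ∀ {x} → 4 * n < 5 * ∣ leaves x ∣ → 1 + j ≤ ∣ leaves x ∣
  many-leaves {x} dom = ≮⇒≥ λ ∣N∣<1+j → <-irrefl refl (begin-strict
    4 * n                   <⟨ dom ⟩
    5 * ∣ leaves x ∣        ≤⟨ *-monoʳ-≤ 5 (≤-pred ∣N∣<1+j) ⟩
    5 * j                   ≤⟨ *-monoˡ-≤ j (m≤m+n 5 3) ⟩
    8 * j                   ≡⟨ solve 1 (λ j → con 8 :* j := con 4 :* (j :+ j)) refl j ⟩
    4 * (j + j)             ≤⟨ *-monoʳ-≤ 4 (≤-trans (+-mono-≤ (m≤n+m j 3) (m≤n+m j 3)) (<⇒≤ n>2k)) ⟩
    4 * n                   ∎)
    where open ≤-Reasoning

  split : Dec (∃[ z ] 4 * n < 5 * ∣ leaves z ∣) → card F ≤ ((n ∸ k ∸ 1) C (2 + j)) + 1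
  split (no ¬dom) = ≤-trans
    (no-large-star-bound (proj₂ n≡3+l) (n ∸ k ∸ 1) n≡m₀+k+1 (≤-trans (threshold≤ j) n≥) (λ z → ≮⇒≥ λ dom → ¬dom (z , dom)))
    (m≤m+n _ 1)
  -- A vertex contained in every member would make the family intersecting, so some member `B`
  -- avoids `x`.
  split (yes (x , dom)) with All.all? (x ∈?_) (members F)
  ... | yes all∋x = ⊥-elim (¬int λ A∈ B∈ → x , x∈p∩q⁺ (All.lookup all∋x A∈ , All.lookup all∋x B∈))
  ... | no ¬all∋x with find (¬All⇒Any¬ (x ∈?_) (members F) ¬all∋x)
  ...   | B , B∈ , x∉B = DominantStar.dominant-star-bound F CI n≡k+k+d n≡m₀+k+1 x dom B∈ x∉B 4C≤d (many-leaves dom)
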